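{- Let $q\ge 6$ be a prime power and let $\mathcal V$ be a ruled quintic surface in $\mathrm{PG}(6,q)$ with conic directrix $\mathcal C$. (1) Any two distinct twisted cubics contained in $\mathcal V$ meet in exactly one point. (2) If $P,Q$ are points of $\mathcal V$ lying on different generators of $\mathcal V$ and not on $\mathcal C$, then there is a unique twisted cubic contained in $\mathcal V$ containing both $P$ and $Q$.
   Context: Construction: in $\mathrm{PG}(6,q)$ let $\alpha$ be a plane and $\Pi_3$ a $3$-space with $\alpha\cap\Pi_3=\emptyset$. Let $\mathcal C$ be a non-degenerate conic in $\alpha$ and $\mathcal N_3$ a twisted cubic in $\Pi_3$, parametrised as $\mathcal C=\{(1,\theta,\theta^2)\}$ and $\mathcal N_3=\{(1,\epsilon,\epsilon^2,\epsilon^3)\}$ ($\theta,\epsilon\in\mathbb F_q\cup\{\infty\}$), and let $\phi\in\mathrm{PGL}(2,q)$ act on parameters, giving a bijection $\mathcal C\to\mathcal N_3$. The ruled quintic surface $\mathcal V$ is the set of points on the $q+1$ lines (generators) joining each point of $\mathcal C$ to its image under $\phi$; $\mathcal C$ is its conic directrix. -}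

module Defs where

open import Level using (0ℓ)
open import Data.Nat using (ℕ; _≤_; _^_)
open import Data.Nat.Primality using (Prime)
open import Data.Fin using (Fin; zero; suc)
open import Data.Product using (Σ; ∃; ∃-syntax; _×_; _,_)
open import Data.Sum using (_⊎_)
open import Relation.Nullary using (¬_)
open import Relation.Binary.PropositionalEquality using (_≡_; _≢_)
open import Algebra.Structures using (IsCommutativeRing)
open import Function.Bundles using (_↔_)

IsPrimePower : ℕ → Set
IsPrimePower q = ∃[ p ] ∃[ k ] (Prime p × 1 ≤ k × q ≡ p ^ k)

record FiniteField (q : ℕ) : Set₁ where
  infixl 6 _+_
  infixl 7 _*_
  field
    Carrier : Set
    _+_ _*_ : Carrier → Carrier → Carrier
    -_      : Carrier → Carrier
    0# 1#   : Carrier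
    isCommutativeRing : IsCommutativeRing _≡_ _+_ _*_ -_ 0# 1#
    0≢1     : 0# ≢ 1#
    inverse : ∀ x → x ≢ 0# → ∃[ y ] (x * y ≡ 1#)
    card    : Carrier ↔ Fin q

module PG6 {q : ℕ} (F : FiniteField q) where
  open FiniteField F

  Vec7 : Set
  Vec7 = Fin 7 → Carrier

  _≐_ : Vec7 → Vec7 → Set
  x ≐ y = ∀ i → x i ≡ y i

  zeroV : Vec7
  zeroV _ = 0#

  _⊕_ : Vec7 → Vec7 → Vec7
  (x ⊕ y) i = x i + y i

  _·_ : Carrier → Vec7 → Vec7
  (k · x) i = k * x i

  infixl 6 _⊕_
  infixl 7 _·_

  NonZero : Vec7 → Set
  NonZero x = ¬ (x ≐ zeroV)

  -- x and y represent the same point of PG(6,q)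
  _∼_ : Vec7 → Vec7 → Set
  x ∼ y = ∃[ k ] (k ≢ 0# × y ≐ (k · x))

  -- a pair of homogeneous parameters (s,t) ≠ (0,0), i.e. a point of PG(1,q)
  NZPair : Carrier → Carrier → Set
  NZPair s t = ¬ (s ≡ 0# × t ≡ 0#)

  PointSet : Set₁
  PointSet = Vec7 → Set

  _∈_ : Vec7 → PointSet → Set
  x ∈ S = NonZero x × S x

  _⊆_ : PointSet → PointSet → Set
  S ⊆ T = ∀ x → x ∈ S → x ∈ T

  SamePoints : PointSet → PointSet → Set
  SamePoints S T = ∀ x → (x ∈ S → x ∈ T) × (x ∈ T → x ∈ S)

  MeetInExactlyOnePoint : PointSet → PointSet → Set
  MeetInExactlyOnePoint S T =
    ∃[ x ] (x ∈ S × x ∈ T × (∀ y → y ∈ S → y ∈ T → y ∼ x))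

  LinIndep4 : Vec7 → Vec7 → Vec7 → Vec7 → Set
  LinIndep4 a₀ a₁ a₂ a₃ = ∀ c₀ c₁ c₂ c₃ →
    (c₀ · a₀ ⊕ c₁ · a₁ ⊕ c₂ · a₂ ⊕ c₃ · a₃) ≐ zeroV →
    (c₀ ≡ 0# × c₁ ≡ 0# × c₂ ≡ 0# × c₃ ≡ 0#)

  -- A twisted cubic of PG(6,q): the image of PG(1,q) under
  -- (s,t) ↦ s³a₀ + s²t a₁ + s t² a₂ + t³ a₃ with a₀,…,a₃ linearly
  -- independent (i.e. projectively equivalent to {(1,ε,ε²,ε³)} in a 3-space).
  record TwistedCubic : Set where
    constructor mkTC
    field
      a₀ a₁ a₂ a₃ : Vec7
      indep : LinIndep4 a₀ a₁ a₂ a₃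

    param : Carrier → Carrier → Vec7
    param s t = (s * s * s) · a₀ ⊕ (s * s * t) · a₁ ⊕ (s * t * t) · a₂ ⊕ (t * t * t) · a₃

    points : PointSet
    points x = ∃[ s ] ∃[ t ] (NZPair s t × x ∼ param s t)

  open TwistedCubic public using (points)

  -- Data of the construction of a ruled quintic surface:
  -- b₀,b₁,b₂ span the plane α, c₀,…,c₃ span the solid Π₃, α ∩ Π₃ = ∅;
  -- conic C = {s²b₀ + st b₁ + t²b₂}, twisted cubic N₃ = {u³c₀+u²v c₁+uv²c₂+v³c₃},
  -- φ ∈ PGL(2,q) given by an invertible matrix (φa φb ; φc φd) acting on
  -- parameters: (s,t) ↦ (φa s + φb t , φc s + φd t).
  record QuinticData : Set where
    field
      b₀ b₁ b₂ c₀ c₁ c₂ c₃ : Vec7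
      α-plane : ∀ e₀ e₁ e₂ → (e₀ · b₀ ⊕ e₁ · b₁ ⊕ e₂ · b₂) ≐ zeroV →
                (e₀ ≡ 0# × e₁ ≡ 0# × e₂ ≡ 0#)
      Π-solid : LinIndep4 c₀ c₁ c₂ c₃
      disjoint : ∀ e₀ e₁ e₂ f₀ f₁ f₂ f₃ →
                 (e₀ · b₀ ⊕ e₁ · b₁ ⊕ e₂ · b₂) ≐ (f₀ · c₀ ⊕ f₁ · c₁ ⊕ f₂ · c₂ ⊕ f₃ · c₃) →
                 (e₀ · b₀ ⊕ e₁ · b₁ ⊕ e₂ · b₂) ≐ zeroV
      φa φb φc φd : Carrier
      φ-invertible : φa * φd + - (φb * φc) ≢ 0#

    conicPt : Carrier → Carrier → Vec7
    conicPt s t = (s * s) · b₀ ⊕ (s * t) · b₁ ⊕ (t * t) · b₂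

    cubicPt : Carrier → Carrier → Vec7
    cubicPt u v = (u * u * u) · c₀ ⊕ (u * u * v) · c₁ ⊕ (u * v * v) · c₂ ⊕ (v * v * v) · c₃

    imagePt : Carrier → Carrier → Vec7
    imagePt s t = cubicPt (φa * s + φb * t) (φc * s + φd * t)

    C : PointSet
    C x = ∃[ s ] ∃[ t ] (NZPair s t × x ∼ conicPt s t)

    generator : Carrier → Carrier → PointSet
    generator s t x = ∃[ λ₁ ] ∃[ μ ] (NZPair λ₁ μ × x ≐ (λ₁ · conicPt s t ⊕ μ · imagePt s t))

    V : PointSet
    V x = ∃[ s ] ∃[ t ] (NZPair s t × generator s t x)

    OnDifferentGenerators : Vec7 → Vec7 → Set
    OnDifferentGenerators P Q =
      ¬ (∃[ s ] ∃[ t ] (NZPair s t × P ∈ generator s t × Q ∈ generator s t))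

{-# OPTIONS --safe #-}
module Submission where

open import Defs
open import Level using (0ℓ)
open import Algebra.Bundles using (CommutativeRing)
import Algebra.Properties.Ring
import Algebra.Properties.Semiring.Mult.TCOptimised
import Algebra.Properties.Semiring.Sum
import Algebra.Solver.Ring
open import Algebra.Solver.Ring.AlmostCommutativeRing
  using (fromCommutativeRing; _-Raw-AlmostCommutative⟶_)
open import Data.Nat as ℕ using (ℕ; zero; suc; _≤_)
import Data.Nat.Properties as ℕ
open import Data.Integer as ℤ using (ℤ; +_; -[1+_]; _⊖_)
import Data.Integer.Properties as ℤ
open import Data.Fin using (Fin; zero; suc; punchIn; punchOut; finToFun; funToFin; combine)
open import Data.Fin.Patterns using (0F; 1F; 2F; 3F; 4F)
import Data.Fin.Properties as Fin
import Data.Maybe as Maybe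
open import Data.Vec using (Vec; []; _∷_; lookup)
open import Data.Vec.Relation.Unary.All as All using ([]; _∷_)
import Data.Vec.Relation.Unary.All.Properties as All
open import Data.Vec.Relation.Unary.AllPairs using ([]; _∷_)
open import Data.Vec.Relation.Unary.Unique.Propositional using (Unique)
open import Data.Vec.Relation.Unary.Unique.Propositional.Properties using (lookup-injective; take⁺)
open import Data.Product using (∃-syntax; Σ-syntax; _×_; _,_; proj₁; proj₂)
open import Data.Sum using (_⊎_; inj₁; inj₂; [_,_]′)
open import Data.Empty using (⊥; ⊥-elim)
open import Function using (_∘_; Inverse; Injective)
open import Relation.Nullary using (¬_; yes; no)
open import Relation.Nullary.Decidable using (map′; dec⇒maybe; ¬?; decidable-stable; True; toWitness)
open import Relation.Binary.Definitions using (DecidableEquality)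
open import Relation.Binary.PropositionalEquality

-- Any five points of a twisted cubic T satisfy a linear relation without zero coefficients. When the
-- points lie on five generators of V, it splits into a relation on the conic and one on the twisted cubic
-- of Π₃. Shearing by a suitable linear form l moves two of the points into Π₃; the conic components of the
-- other three then satisfy a linear relation, although three points of a conic are independent, so they
-- vanish. Hence T is a section { l(h) conic(h) + cubic(h) }. That T meets every generator exactly once
-- follows from such relations too. Two sections agree exactly where l − l′ vanishes, and two points of V
-- off C on different generators prescribe two values of l.

-- The inclusion of T in V is pointwise: for each parameter P it yields some generator `base P` and
-- coordinates `ℓ P`, `μ P` on it, as bare functions with no polynomial form. Degree arguments are
-- therefore not directly available, and every fact about T has to come from linear relations among
-- finitely many of its points. `base` is shown to be a bijection, which suffices because only point
-- sets are compared. The bound on `q` enters by supplying distinct parameters for these relations;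
-- excluding two points of T on one generator works with six parameters at once. The form l is taken
-- linear because its product with a quadratic form is then cubic, so that the relation in Π₃
-- applies to it.

abstract
  -- A missed value could be punched out of the codomain, leaving an injection into a set with one
  -- element fewer.
  surjective : ∀ {n} {f : Fin n → Fin n} → Injective _≡_ _≡_ f → ∀ y → ∃[ x ] f x ≡ y
  surjective {suc n} {f} f-injective y with Fin.any? (λ x → f x Fin.≟ y)
  ... | yes hit = hit
  ... | no miss = ⊥-elim (Fin.<⇒notInjective ℕ.≤-refl avoid-injective)
    where
    y≢f : ∀ x → y ≢ f x
    y≢f x y≡fx = miss (x , sym y≡fx)
    avoid-injective : Injective _≡_ _≡_ (λ x → punchOut (y≢f x))
    avoid-injective e = f-injective (Fin.punchOut-injective (y≢f _) (y≢f _) e)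

  -- Without a fresh element every value occurs in `xs`, and choosing a position for each value
  -- would inject `Fin n` into `Fin k`.
  extend : ∀ {n k} {xs : Vec (Fin n) k} → k ℕ.< n → Unique xs → ∃[ y ] Unique (y ∷ xs)
  extend {n} {k} {xs} k<n xs! with Fin.any? (λ y → All.all? (λ x → ¬? (y Fin.≟ x)) xs)
  ... | yes (y , fresh) = y , (fresh ∷ xs!)
  ... | no none = ⊥-elim (Fin.<⇒notInjective k<n (λ {y} {z} e →
      trans (sym (proj₂ (position y))) (trans (cong (lookup xs) e) (proj₂ (position z)))))
    where
    position : ∀ y → ∃[ i ] lookup xs i ≡ y
    position y = decidable-stable (Fin.any? (λ i → lookup xs i Fin.≟ y))
      (λ absent → none (y , All.lookup⁻ (λ i y≡ → absent (i , sym y≡))))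

punchIn-cases : ∀ {n} (j i : Fin (suc n)) → i ≡ j ⊎ (∃[ i′ ] i ≡ punchIn j i′)
punchIn-cases j i with j Fin.≟ i
... | yes j≡i = inj₁ (sym j≡i)
... | no j≢i  = inj₂ (punchOut j≢i , sym (Fin.punchIn-punchOut j≢i))

funToFin-cong : ∀ {m n} {f g : Fin m → Fin n} → f ≗ g → funToFin f ≡ funToFin g
funToFin-cong {zero}  f≗g = refl
funToFin-cong {suc m} f≗g = cong₂ combine (f≗g zero) (funToFin-cong (f≗g ∘ suc))

module Geometry {q : ℕ} (F : FiniteField q) where
  open FiniteField F public

  commutativeRing : CommutativeRing 0ℓ 0ℓ
  commutativeRing = record { isCommutativeRing = isCommutativeRing }

  open CommutativeRing commutativeRing public
    using ( ring; semiring; zeroˡ; zeroʳ; +-identityˡ; +-identityʳ; *-identityˡ; *-identityʳ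
          ; *-comm; *-assoc; +-comm; +-assoc; -‿inverseʳ )
  open Algebra.Properties.Ring ring
    using (-‿involutive; -‿distribˡ-*; -‿distribʳ-*; -‿+-comm; -0#≈0#; x∙y⁻¹≈ε⇒x≈y; x≈y⇒x∙y⁻¹≈ε)
    public
  open Algebra.Properties.Semiring.Mult.TCOptimised semiring using (1+×; ×-homo-+; ×1-homo-*) renaming (_×_ to _⋆_)
  open Algebra.Properties.Semiring.Sum semiring public
    using (sum; sum-remove; sum-cong-≗; ∑-distrib-+; ∑-comm; *-distribˡ-sum; *-distribʳ-sum; sum-replicate-zero)
  open ≡-Reasoning

  -- A ring solver for the field with integer coefficients.

  fromℤ : ℤ → Carrier
  fromℤ (+ n)    = n ⋆ 1#
  fromℤ -[1+ n ] = - (suc n ⋆ 1#)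

  fromℤ-neg : ∀ i → fromℤ (ℤ.- i) ≡ - fromℤ i
  fromℤ-neg (+ zero)  = sym -0#≈0#
  fromℤ-neg (+ suc n) = refl
  fromℤ-neg -[1+ n ]  = sym (-‿involutive _)

  fromℤ-⊖ : ∀ m n → fromℤ (m ⊖ n) ≡ m ⋆ 1# + - (n ⋆ 1#)
  fromℤ-⊖ m zero = begin
    fromℤ (m ⊖ 0)      ≡⟨ cong fromℤ (ℤ.⊖-≥ {m} {0} ℕ.z≤n) ⟩
    m ⋆ 1#             ≡⟨ +-identityʳ _ ⟨
    m ⋆ 1# + 0#        ≡⟨ cong (λ z → m ⋆ 1# + z) -0#≈0# ⟨
    m ⋆ 1# + - 0#      ∎
  fromℤ-⊖ zero (suc n) = sym (+-identityˡ _)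
  fromℤ-⊖ (suc m) (suc n) = begin
    fromℤ (suc m ⊖ suc n)                   ≡⟨ cong fromℤ (ℤ.[1+m]⊖[1+n]≡m⊖n m n) ⟩
    fromℤ (m ⊖ n)                           ≡⟨ fromℤ-⊖ m n ⟩
    a + - b                                 ≡⟨ cong (_+ - b) (+-identityʳ a) ⟨
    a + 0# + - b                            ≡⟨ cong (λ z → a + z + - b) (-‿inverseʳ 1#) ⟨
    a + (1# + - 1#) + - b                   ≡⟨ cong (_+ - b) (+-assoc a 1# (- 1#)) ⟨
    a + 1# + - 1# + - b                     ≡⟨ +-assoc _ _ _ ⟩
    a + 1# + (- 1# + - b)                   ≡⟨ cong₂ _+_ (+-comm a 1#) (-‿+-comm 1# b) ⟩
    1# + a + - (1# + b)                     ≡⟨ cong₂ (λ x y → x + - y) (1+× m 1#) (1+× n 1#) ⟨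
    suc m ⋆ 1# + - (suc n ⋆ 1#)             ∎
    where
    a = m ⋆ 1#
    b = n ⋆ 1#

  fromℤ-+ : ∀ i j → fromℤ (i ℤ.+ j) ≡ fromℤ i + fromℤ j
  fromℤ-+ (+ m)    (+ n)    = ×-homo-+ 1# m n
  fromℤ-+ (+ m)    -[1+ n ] = fromℤ-⊖ m (suc n)
  fromℤ-+ -[1+ m ] (+ n)    = trans (fromℤ-⊖ n (suc m)) (+-comm _ _)
  fromℤ-+ -[1+ m ] -[1+ n ] = begin
    - ((suc (suc (m ℕ.+ n))) ⋆ 1#)       ≡⟨ cong (λ k → - (suc k ⋆ 1#)) (ℕ.+-suc m n) ⟨
    - ((suc m ℕ.+ suc n) ⋆ 1#)           ≡⟨ cong -_ (×-homo-+ 1# (suc m) (suc n)) ⟩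
    - (suc m ⋆ 1# + suc n ⋆ 1#)          ≡⟨ -‿+-comm _ _ ⟨
    - (suc m ⋆ 1#) + - (suc n ⋆ 1#)      ∎

  fromℤ-pos-* : ∀ m j → fromℤ (+ m ℤ.* j) ≡ fromℤ (+ m) * fromℤ j
  fromℤ-pos-* m (+ n) = trans (cong fromℤ (sym (ℤ.pos-* m n))) (×1-homo-* m n)
  fromℤ-pos-* m -[1+ n ] = begin
    fromℤ (+ m ℤ.* -[1+ n ])            ≡⟨ cong fromℤ (ℤ.neg-distribʳ-* (+ m) (+ suc n)) ⟨
    fromℤ (ℤ.- (+ m ℤ.* + suc n))       ≡⟨ fromℤ-neg (+ m ℤ.* + suc n) ⟩
    - fromℤ (+ m ℤ.* + suc n)           ≡⟨ cong -_ (fromℤ-pos-* m (+ suc n)) ⟩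
    - (fromℤ (+ m) * fromℤ (+ suc n))   ≡⟨ -‿distribʳ-* _ _ ⟩
    fromℤ (+ m) * - fromℤ (+ suc n)     ∎

  fromℤ-* : ∀ i j → fromℤ (i ℤ.* j) ≡ fromℤ i * fromℤ j
  fromℤ-* (+ m)    j = fromℤ-pos-* m j
  fromℤ-* -[1+ m ] j = begin
    fromℤ (-[1+ m ] ℤ.* j)              ≡⟨ cong fromℤ (ℤ.neg-distribˡ-* (+ suc m) j) ⟨
    fromℤ (ℤ.- (+ suc m ℤ.* j))         ≡⟨ fromℤ-neg (+ suc m ℤ.* j) ⟩
    - fromℤ (+ suc m ℤ.* j)             ≡⟨ cong -_ (fromℤ-pos-* (suc m) j) ⟩
    - (fromℤ (+ suc m) * fromℤ j)       ≡⟨ -‿distribˡ-* _ _ ⟩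
    - fromℤ (+ suc m) * fromℤ j         ∎

  -- The solver has to compare coefficients by evaluation; equality on the abstract `Carrier` does
  -- not evaluate, equality on ℤ does. Since `1 ⋆ 1#` computes to `1#`, the solver constants 0, 1
  -- and -1 are definitionally `0#`, `1#` and `- 1#`.
  ℤ⟶field : ℤ.+-*-rawRing -Raw-AlmostCommutative⟶ fromCommutativeRing commutativeRing
  ℤ⟶field = record
    { ⟦_⟧    = fromℤ
    ; +-homo = fromℤ-+
    ; *-homo = fromℤ-*
    ; -‿homo = fromℤ-neg
    ; 0-homo = refl
    ; 1-homo = refl
    }

  open Algebra.Solver.Ring ℤ.+-*-rawRing (fromCommutativeRing commutativeRing) ℤ⟶field
    (λ i j → Maybe.map (cong fromℤ) (dec⇒maybe (i ℤ.≟ j))) public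
    using (solve; _:=_; _:+_; _:*_; :-_; con)

  -- Decidable equality and cancellation in the field.

  to-injective : ∀ {x y} → Inverse.to card x ≡ Inverse.to card y → x ≡ y
  to-injective e = trans (sym (Inverse.strictlyInverseʳ card _))
    (trans (cong (Inverse.from card) e) (Inverse.strictlyInverseʳ card _))

  _≟_ : DecidableEquality Carrier
  x ≟ y = map′ to-injective (cong (Inverse.to card)) (Inverse.to card x Fin.≟ Inverse.to card y)

  *-zero-cancelˡ : ∀ {x y} → x ≢ 0# → x * y ≡ 0# → y ≡ 0#
  *-zero-cancelˡ {x} {y} x≢0 xy≡0 with inverse x x≢0
  ... | z , xz≡1 = begin
    y             ≡⟨ *-identityˡ y ⟨
    1# * y        ≡⟨ cong (_* y) xz≡1 ⟨
    x * z * y     ≡⟨ cong (_* y) (*-comm x z) ⟩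
    z * x * y     ≡⟨ *-assoc z x y ⟩
    z * (x * y)   ≡⟨ cong (z *_) xy≡0 ⟩
    z * 0#        ≡⟨ zeroʳ z ⟩
    0#            ∎

  *-zero-cancelʳ : ∀ {x y} → y ≢ 0# → x * y ≡ 0# → x ≡ 0#
  *-zero-cancelʳ {x} {y} y≢0 xy≡0 = *-zero-cancelˡ y≢0 (trans (*-comm y x) xy≡0)

  *-nonzero : ∀ {x y} → x ≢ 0# → y ≢ 0# → x * y ≢ 0#
  *-nonzero x≢0 y≢0 xy≡0 = y≢0 (*-zero-cancelˡ x≢0 xy≡0)

  *-cancelˡ : ∀ {x y z} → x ≢ 0# → x * y ≡ x * z → y ≡ z
  *-cancelˡ {x} {y} {z} x≢0 e = x∙y⁻¹≈ε⇒x≈y y z (*-zero-cancelˡ x≢0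
    (trans (solve 3 (λ x y z → x :* (y :+ :- z) := x :* y :+ :- (x :* z)) refl x y z)
      (x≈y⇒x∙y⁻¹≈ε e)))

  1<q : 1 ℕ.< q
  1<q = Fin.injective⇒≤ {f = coordinate} injective
    where
    coordinate : Fin 2 → Fin q
    coordinate zero    = Inverse.to card 0#
    coordinate (suc _) = Inverse.to card 1#
    injective : Injective _≡_ _≡_ coordinate
    injective {zero}     {zero}     e = refl
    injective {zero}     {suc zero} e = ⊥-elim (0≢1 (to-injective e))
    injective {suc zero} {zero}     e = ⊥-elim (0≢1 (sym (to-injective e)))
    injective {suc zero} {suc zero} e = refl

  -- Finite sums and linear dependence.

  sum-zero : ∀ {n} {t : Fin n → Carrier} → (∀ i → t i ≡ 0#) → sum t ≡ 0#
  sum-zero {n} t≗0 = trans (sum-cong-≗ t≗0) (sum-replicate-zero n)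

  sum-single : ∀ {n} (t : Fin n → Carrier) j → (∀ i → i ≢ j → t i ≡ 0#) → sum t ≡ t j
  sum-single {suc n} t j t≡0 = begin
    sum t                              ≡⟨ sum-remove {i = j} t ⟩
    t j + sum (λ i → t (punchIn j i))  ≡⟨ cong (λ z → t j + z) (sum-zero (λ i → t≡0 _ (Fin.punchInᵢ≢i j i))) ⟩
    t j + 0#                           ≡⟨ +-identityʳ _ ⟩
    t j                                ∎

  sum-swap : ∀ {m n} (w : Fin m → Carrier) (v : Fin m → Fin n → Carrier) (k : Fin n → Carrier) →
    sum (λ i → w i * sum (λ j → v i j * k j)) ≡ sum (λ j → sum (λ i → w i * v i j) * k j)
  sum-swap w v k = begin
    sum (λ i → w i * sum (λ j → v i j * k j))     ≡⟨ sum-cong-≗ (λ i → *-distribˡ-sum (w i) (λ j → v i j * k j)) ⟩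
    sum (λ i → sum (λ j → w i * (v i j * k j)))   ≡⟨ ∑-comm (λ i j → w i * (v i j * k j)) ⟩
    sum (λ j → sum (λ i → w i * (v i j * k j)))   ≡⟨ sum-cong-≗ (λ j → sum-cong-≗ (λ i → *-assoc (w i) (v i j) (k j))) ⟨
    sum (λ j → sum (λ i → w i * v i j * k j))     ≡⟨ sum-cong-≗ (λ j → *-distribʳ-sum (k j) (λ i → w i * v i j)) ⟨
    sum (λ j → sum (λ i → w i * v i j) * k j)     ∎

  -- Applying the functional with coefficients `k` to a linear relation gives a scalar relation.
  -- This is how forms are paired with relations below.
  sum-annihilate : ∀ {m n} (w : Fin m → Carrier) (v : Fin m → Fin n → Carrier) (k : Fin n → Carrier) →
    (∀ j → sum (λ i → w i * v i j) ≡ 0#) → sum (λ i → w i * sum (λ j → v i j * k j)) ≡ 0#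
  sum-annihilate w v k wv≡0 = trans (sum-swap w v k)
    (sum-zero (λ j → trans (cong (_* k j) (wv≡0 j)) (zeroˡ (k j))))

  -- Coefficient vectors and their combinations are coded as elements of `Fin (q ^ m)` and
  -- `Fin (q ^ n)`, where the pigeonhole principle applies.
  combination : ∀ {m n} → (Fin m → Fin n → Carrier) → Fin (q ℕ.^ m) → Fin (q ℕ.^ n)
  combination v k = funToFin (λ j → Inverse.to card (sum (λ i → Inverse.from card (finToFun k i) * v i j)))

  -- The relation is the difference of the two decoded coefficient vectors, which is nonzero because
  -- distinct codes decode to distinct vectors.
  collision⇒dependent : ∀ {m n} (v : Fin m → Fin n → Carrier) {k l} → k ≢ l →
    combination v k ≡ combination v l →
    Σ[ d ∈ (Fin m → Carrier) ] (¬ (∀ i → d i ≡ 0#)) × (∀ j → sum (λ i → d i * v i j) ≡ 0#)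
  collision⇒dependent {m} {n} v {k} {l} k≢l e = d , d≢0 , relation
    where
    x y d : Fin m → Carrier
    x i = Inverse.from card (finToFun k i)
    y i = Inverse.from card (finToFun l i)
    d i = x i + - y i
    same : ∀ j → sum (λ i → x i * v i j) ≡ sum (λ i → y i * v i j)
    same j = to-injective (begin
      _ ≡⟨ Fin.finToFun-funToFin _ j ⟨
      _ ≡⟨ cong (λ z → finToFun z j) e ⟩
      _ ≡⟨ Fin.finToFun-funToFin _ j ⟩
      _ ∎)
    from-injective : ∀ {a b} → Inverse.from card a ≡ Inverse.from card b → a ≡ b
    from-injective e = trans (sym (Inverse.strictlyInverseˡ card _))
      (trans (cong (Inverse.to card) e) (Inverse.strictlyInverseˡ card _))
    d≢0 : ¬ (∀ i → d i ≡ 0#)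
    d≢0 d≡0 = k≢l (begin
      k                      ≡⟨ Fin.funToFin-finToFin {m} {q} k ⟨
      funToFin (finToFun {q} {m} k)  ≡⟨ funToFin-cong (λ i → from-injective (x∙y⁻¹≈ε⇒x≈y _ _ (d≡0 i))) ⟩
      funToFin (finToFun {q} {m} l)  ≡⟨ Fin.funToFin-finToFin {m} {q} l ⟩
      l                      ∎)
    relation : ∀ j → sum (λ i → d i * v i j) ≡ 0#
    relation j = begin
      sum (λ i → d i * v i j)
        ≡⟨ sum-cong-≗ (λ i → solve 3 (λ x y v → (x :+ :- y) :* v := x :* v :+ con (-[1+ 0 ]) :* (y :* v)) refl (x i) (y i) (v i j)) ⟩
      sum (λ i → x i * v i j + fromℤ -[1+ 0 ] * (y i * v i j))
        ≡⟨ ∑-distrib-+ (λ i → x i * v i j) (λ i → fromℤ -[1+ 0 ] * (y i * v i j)) ⟩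
      sum (λ i → x i * v i j) + sum (λ i → fromℤ -[1+ 0 ] * (y i * v i j))
        ≡⟨ cong₂ _+_ (same j) (sym (*-distribˡ-sum (fromℤ -[1+ 0 ]) (λ i → y i * v i j))) ⟩
      s + fromℤ -[1+ 0 ] * s
        ≡⟨ solve 1 (λ s → s :+ con (-[1+ 0 ]) :* s := con (+ 0)) refl s ⟩
      0# ∎
      where
      s : Carrier
      s = sum (λ i → y i * v i j)

  -- Of the q ^ m coefficient vectors, two must give the same combination in the q ^ n vectors of length n.
  abstract
    dependent : ∀ {m n : ℕ} → n ℕ.< m → (v : Fin m → Fin n → Carrier) →
      Σ[ d ∈ (Fin m → Carrier) ] (¬ (∀ i → d i ≡ 0#)) × (∀ j → sum (λ i → d i * v i j) ≡ 0#)
    dependent n<m v =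
      let k , l , k<l , e = Fin.pigeonhole (ℕ.^-monoʳ-< q 1<q n<m) (combination v)
      in collision⇒dependent v (Fin.<⇒≢ k<l) e

  -- Points of the projective line.

  -- The normalised representatives (0 , 1) and (1 , t) of the points of PG(1,q).
  Point : Set
  Point = Fin (suc q)

  X Y : Point → Carrier
  X zero    = 0#
  X (suc t) = 1#
  Y zero    = 1#
  Y (suc t) = Inverse.from card t

  -- The 2×2 determinant of the representatives; as a linear form in `P` it vanishes exactly at `R`.
  bracket : Point → Point → Carrier
  bracket P R = X P * Y R + - (Y P * X R)

  bracket-self : ∀ P → bracket P P ≡ 0#
  bracket-self P = solve 2 (λ x y → x :* y :+ :- (y :* x) := con (+ 0)) refl (X P) (Y P)

  bracket≢0 : ∀ {P R} → P ≢ R → bracket P R ≢ 0#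
  bracket≢0 {zero}  {zero}  P≢R _ = P≢R refl
  bracket≢0 {zero}  {suc t} _   e = 0≢1 (begin
    0#                              ≡⟨ -0#≈0# ⟨
    - 0#                            ≡⟨ cong -_ e ⟨
    - (0# * y + - (1# * 1#))        ≡⟨ solve 1 (λ y → :- (con (+ 0) :* y :+ :- (con (+ 1) :* con (+ 1))) := con (+ 1)) refl y ⟩
    1#                              ∎)
    where y = Inverse.from card t
  bracket≢0 {suc t} {zero}  _   e = 0≢1 (begin
    0#                              ≡⟨ e ⟨
    1# * 1# + - (y * 0#)            ≡⟨ solve 1 (λ y → con (+ 1) :* con (+ 1) :+ :- (y :* con (+ 0)) := con (+ 1)) refl y ⟩
    1#                              ∎)
    where y = Inverse.from card t
  bracket≢0 {suc t} {suc u} P≢R e = P≢R (cong suc (trans (sym (Inverse.strictlyInverseˡ card t))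
    (trans (cong (Inverse.to card) (sym y≡z)) (Inverse.strictlyInverseˡ card u))))
    where
    y = Inverse.from card t
    z = Inverse.from card u
    y≡z : z ≡ y
    y≡z = x∙y⁻¹≈ε⇒x≈y z y (trans (cong₂ (λ a b → a + - b) (sym (*-identityˡ z)) (sym (*-identityʳ y))) e)

  abstract
    normalise : ∀ s t → ¬ (s ≡ 0# × t ≡ 0#) → ∃[ P ] ∃[ k ] (k ≢ 0# × s ≡ k * X P × t ≡ k * Y P)
    normalise s t st≢0 with s ≟ 0#
    ... | yes s≡0 = zero , t , (λ t≡0 → st≢0 (s≡0 , t≡0)) , trans s≡0 (sym (zeroʳ t)) , sym (*-identityʳ t)
    ... | no s≢0 with inverse s s≢0
    ...   | r , sr≡1 = suc (Inverse.to card (r * t)) , s , s≢0 , sym (*-identityʳ s) , (begin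
      t                                                        ≡⟨ *-identityˡ t ⟨
      1# * t                                                   ≡⟨ cong (_* t) sr≡1 ⟨
      s * r * t                                                ≡⟨ *-assoc s r t ⟩
      s * (r * t)                                              ≡⟨ cong (s *_) (Inverse.strictlyInverseʳ card (r * t)) ⟨
      s * Inverse.from card (Inverse.to card (r * t))          ∎)

  XY≢0 : ∀ P → ¬ (X P ≡ 0# × Y P ≡ 0#)
  XY≢0 zero    (_ , 1≡0) = 0≢1 (sym 1≡0)
  XY≢0 (suc t) (1≡0 , _) = 0≢1 (sym 1≡0)

  -- Linear relations on conics and twisted cubics.

  ν₂ : Carrier → Carrier → Fin 3 → Carrier
  ν₂ s t zero             = s * s
  ν₂ s t (suc zero)       = s * t
  ν₂ s t (suc (suc zero)) = t * t

  ν₃ : Carrier → Carrier → Fin 4 → Carrier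
  ν₃ s t zero                   = s * s * s
  ν₃ s t (suc zero)             = s * s * t
  ν₃ s t (suc (suc zero))       = s * t * t
  ν₃ s t (suc (suc (suc zero))) = t * t * t

  conic : Point → Fin 3 → Carrier
  conic P = ν₂ (X P) (Y P)

  cubic : Point → Fin 4 → Carrier
  cubic P = ν₃ (X P) (Y P)

  -- Pair a relation with the product of linear forms vanishing at the unwanted points.
  conic-isolate : ∀ {n} (w : Fin n → Carrier) (p : Fin n → Point) →
    (∀ j → sum (λ i → w i * conic (p i) j) ≡ 0#) →
    ∀ j {A B} → p j ≢ A → p j ≢ B →
    (∀ i → i ≢ j → w i ≡ 0# ⊎ p i ≡ A ⊎ p i ≡ B) → w j ≡ 0#
  conic-isolate w p relation j {A} {B} j≢A j≢B others =
    *-zero-cancelʳ (*-nonzero (bracket≢0 j≢A) (bracket≢0 j≢B)) (begin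
      w j * form (p j)                           ≡⟨ sum-single (λ i → w i * form (p i)) j (λ i i≢j → vanish i (others i i≢j)) ⟨
      sum (λ i → w i * form (p i))               ≡⟨ sum-cong-≗ (λ i → cong (w i *_) (expand (p i))) ⟩
      sum (λ i → w i * sum (λ j → conic (p i) j * k j))  ≡⟨ sum-annihilate w (conic ∘ p) k relation ⟩
      0#                                         ∎)
    where
    form : Point → Carrier
    form P = bracket P A * bracket P B
    k : Fin 3 → Carrier
    k zero             = Y A * Y B
    k (suc zero)       = - (X A * Y B + Y A * X B)
    k (suc (suc zero)) = X A * X B
    expand : ∀ P → form P ≡ sum (λ j → conic P j * k j)
    expand P = solve 6 (λ x y a a′ b b′ →
      (x :* a′ :+ :- (y :* a)) :* (x :* b′ :+ :- (y :* b)) :=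
      x :* x :* (a′ :* b′) :+ (x :* y :* (:- (a :* b′ :+ a′ :* b)) :+ (y :* y :* (a :* b) :+ con (+ 0))))
      refl (X P) (Y P) (X A) (Y A) (X B) (Y B)
    vanish : ∀ i → w i ≡ 0# ⊎ p i ≡ A ⊎ p i ≡ B → w i * form (p i) ≡ 0#
    vanish i (inj₁ w≡0) = trans (cong (_* form (p i)) w≡0) (zeroˡ _)
    vanish i (inj₂ (inj₁ refl)) = begin
      w i * (bracket A A * bracket A B)   ≡⟨ cong (λ z → w i * (z * bracket A B)) (bracket-self A) ⟩
      w i * (0# * bracket A B)            ≡⟨ solve 2 (λ w x → w :* (con (+ 0) :* x) := con (+ 0)) refl (w i) _ ⟩
      0#                                  ∎
    vanish i (inj₂ (inj₂ refl)) = begin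
      w i * (bracket B A * bracket B B)   ≡⟨ cong (λ z → w i * (bracket B A * z)) (bracket-self B) ⟩
      w i * (bracket B A * 0#)            ≡⟨ solve 2 (λ w x → w :* (x :* con (+ 0)) := con (+ 0)) refl (w i) _ ⟩
      0#                                  ∎

  -- The product now has three roots. `A`, `B` and `C` may coincide, so the same form also serves
  -- when fewer points have to be removed.
  cubic-isolate : ∀ {n} (w : Fin n → Carrier) (p : Fin n → Point) →
    (∀ j → sum (λ i → w i * cubic (p i) j) ≡ 0#) →
    ∀ j {A B C} → p j ≢ A → p j ≢ B → p j ≢ C →
    (∀ i → i ≢ j → w i ≡ 0# ⊎ p i ≡ A ⊎ p i ≡ B ⊎ p i ≡ C) → w j ≡ 0#
  cubic-isolate w p relation j {A} {B} {C} j≢A j≢B j≢C others =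
    *-zero-cancelʳ (*-nonzero (*-nonzero (bracket≢0 j≢A) (bracket≢0 j≢B)) (bracket≢0 j≢C)) (begin
      w j * form (p j)                           ≡⟨ sum-single (λ i → w i * form (p i)) j (λ i i≢j → vanish i (others i i≢j)) ⟨
      sum (λ i → w i * form (p i))               ≡⟨ sum-cong-≗ (λ i → cong (w i *_) (expand (p i))) ⟩
      sum (λ i → w i * sum (λ j → cubic (p i) j * k j))  ≡⟨ sum-annihilate w (cubic ∘ p) k relation ⟩
      0#                                         ∎)
    where
    form : Point → Carrier
    form P = bracket P A * bracket P B * bracket P C
    k : Fin 4 → Carrier
    k zero                   = Y A * Y B * Y C
    k (suc zero)             = - (X A * Y B * Y C + Y A * X B * Y C + Y A * Y B * X C)
    k (suc (suc zero))       = X A * X B * Y C + X A * Y B * X C + Y A * X B * X C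
    k (suc (suc (suc zero))) = - (X A * X B * X C)
    expand : ∀ P → form P ≡ sum (λ j → cubic P j * k j)
    expand P = solve 8 (λ x y a a′ b b′ c c′ →
      (x :* a′ :+ :- (y :* a)) :* (x :* b′ :+ :- (y :* b)) :* (x :* c′ :+ :- (y :* c)) :=
      x :* x :* x :* (a′ :* b′ :* c′)
      :+ (x :* x :* y :* (:- (a :* b′ :* c′ :+ a′ :* b :* c′ :+ a′ :* b′ :* c))
      :+ (x :* y :* y :* (a :* b :* c′ :+ a :* b′ :* c :+ a′ :* b :* c)
      :+ (y :* y :* y :* (:- (a :* b :* c)) :+ con (+ 0)))))
      refl (X P) (Y P) (X A) (Y A) (X B) (Y B) (X C) (Y C)
    vanish : ∀ i → w i ≡ 0# ⊎ p i ≡ A ⊎ p i ≡ B ⊎ p i ≡ C → w i * form (p i) ≡ 0#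
    vanish i (inj₁ w≡0) = trans (cong (_* form (p i)) w≡0) (zeroˡ _)
    vanish i (inj₂ (inj₁ refl)) = begin
      w i * (bracket A A * bracket A B * bracket A C)   ≡⟨ cong (λ z → w i * (z * bracket A B * bracket A C)) (bracket-self A) ⟩
      w i * (0# * bracket A B * bracket A C)            ≡⟨ solve 3 (λ w x y → w :* (con (+ 0) :* x :* y) := con (+ 0)) refl (w i) _ _ ⟩
      0#                                                ∎
    vanish i (inj₂ (inj₂ (inj₁ refl))) = begin
      w i * (bracket B A * bracket B B * bracket B C)   ≡⟨ cong (λ z → w i * (bracket B A * z * bracket B C)) (bracket-self B) ⟩
      w i * (bracket B A * 0# * bracket B C)            ≡⟨ solve 3 (λ w x y → w :* (x :* con (+ 0) :* y) := con (+ 0)) refl (w i) _ _ ⟩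
      0#                                                ∎
    vanish i (inj₂ (inj₂ (inj₂ refl))) = begin
      w i * (bracket C A * bracket C B * bracket C C)   ≡⟨ cong (λ z → w i * (bracket C A * bracket C B * z)) (bracket-self C) ⟩
      w i * (bracket C A * bracket C B * 0#)            ≡⟨ solve 3 (λ w x y → w :* (x :* y :* con (+ 0)) := con (+ 0)) refl (w i) _ _ ⟩
      0#                                                ∎

  -- Any four points of a twisted cubic are independent. Puncturing the index set at `j` and then at
  -- `k` leaves three indices, and the cubic form vanishing at their points isolates `w j`.
  cubic-relation : (w : Fin 5 → Carrier) (p : Fin 5 → Point) → Injective _≡_ _≡_ p →
    (∀ j → sum (λ i → w i * cubic (p i) j) ≡ 0#) → ∀ {k} → w k ≡ 0# → ∀ i → w i ≡ 0#
  cubic-relation w p p-injective relation {k} wk≡0 j with punchIn-cases j k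
  ... | inj₁ refl = wk≡0
  ... | inj₂ (k′ , refl) =
    cubic-isolate w p relation j (distinct _) (distinct _) (distinct _) others
    where
    distinct : ∀ i → p j ≢ p (punchIn j i)
    distinct i e = Fin.punchInᵢ≢i j i (sym (p-injective e))
    others : ∀ i → i ≢ j → w i ≡ 0# ⊎ p i ≡ p (punchIn j (punchIn k′ zero)) ⊎
      p i ≡ p (punchIn j (punchIn k′ (suc zero))) ⊎ p i ≡ p (punchIn j (punchIn k′ (suc (suc zero))))
    others i i≢j with punchIn-cases j i
    ... | inj₁ i≡j = ⊥-elim (i≢j i≡j)
    ... | inj₂ (i′ , refl) with punchIn-cases k′ i′
    ...   | inj₁ refl = inj₁ wk≡0
    ...   | inj₂ (zero , refl) = inj₂ (inj₁ refl)
    ...   | inj₂ (suc zero , refl) = inj₂ (inj₂ (inj₁ refl))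
    ...   | inj₂ (suc (suc zero) , refl) = inj₂ (inj₂ (inj₂ refl))

  -- Linear forms on the projective line.

  linear : Carrier → Carrier → Point → Carrier
  linear l₀ l₁ P = l₀ * X P + l₁ * Y P

  abstract
    -- Cramer's rule, with `r` the inverse of the determinant.
    interpolate : ∀ {A B} → A ≢ B → ∀ u v → ∃[ l₀ ] ∃[ l₁ ] (linear l₀ l₁ A ≡ u × linear l₀ l₁ B ≡ v)
    interpolate {A} {B} A≢B u v with inverse (bracket A B) (bracket≢0 A≢B)
    ... | r , Δr≡1 = l₀ , l₁ , at-A , at-B
      where
      l₀ l₁ : Carrier
      l₀ = r * (u * Y B + - (v * Y A))
      l₁ = r * (X A * v + - (X B * u))
      at-A : linear l₀ l₁ A ≡ u
      at-A = begin
        linear l₀ l₁ A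
          ≡⟨ solve 7 (λ a a′ b b′ u v r → r :* (u :* b′ :+ :- (v :* a′)) :* a :+ r :* (a :* v :+ :- (b :* u)) :* a′
              := (a :* b′ :+ :- (a′ :* b)) :* r :* u) refl (X A) (Y A) (X B) (Y B) u v r ⟩
        bracket A B * r * u ≡⟨ cong (_* u) Δr≡1 ⟩
        1# * u              ≡⟨ *-identityˡ u ⟩
        u                   ∎
      at-B : linear l₀ l₁ B ≡ v
      at-B = begin
        linear l₀ l₁ B
          ≡⟨ solve 7 (λ a a′ b b′ u v r → r :* (u :* b′ :+ :- (v :* a′)) :* b :+ r :* (a :* v :+ :- (b :* u)) :* b′
              := (a :* b′ :+ :- (a′ :* b)) :* r :* v) refl (X A) (Y A) (X B) (Y B) u v r ⟩
        bracket A B * r * v ≡⟨ cong (_* v) Δr≡1 ⟩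
        1# * v              ≡⟨ *-identityˡ v ⟩
        v                   ∎

  linear-unique : ∀ {A B} → A ≢ B → ∀ {l₀ l₁ m₀ m₁} → linear l₀ l₁ A ≡ linear m₀ m₁ A →
    linear l₀ l₁ B ≡ linear m₀ m₁ B → l₀ ≡ m₀ × l₁ ≡ m₁
  linear-unique {A} {B} A≢B {l₀} {l₁} {m₀} {m₁} eA eB =
    *-cancelˡ Δ≢0 (begin
      bracket A B * l₀                                         ≡⟨ cramer₀ l₀ l₁ ⟩
      linear l₀ l₁ A * Y B + - (linear l₀ l₁ B * Y A)          ≡⟨ cong₂ (λ x y → x * Y B + - (y * Y A)) eA eB ⟩
      linear m₀ m₁ A * Y B + - (linear m₀ m₁ B * Y A)          ≡⟨ cramer₀ m₀ m₁ ⟨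
      bracket A B * m₀                                         ∎) ,
    *-cancelˡ Δ≢0 (begin
      bracket A B * l₁                                         ≡⟨ cramer₁ l₀ l₁ ⟩
      X A * linear l₀ l₁ B + - (X B * linear l₀ l₁ A)          ≡⟨ cong₂ (λ x y → X A * y + - (X B * x)) eA eB ⟩
      X A * linear m₀ m₁ B + - (X B * linear m₀ m₁ A)          ≡⟨ cramer₁ m₀ m₁ ⟨
      bracket A B * m₁                                         ∎)
    where
    Δ≢0 = bracket≢0 A≢B
    cramer₀ : ∀ x y → bracket A B * x ≡ linear x y A * Y B + - (linear x y B * Y A)
    cramer₀ x y = solve 6 (λ a a′ b b′ x y → (a :* b′ :+ :- (a′ :* b)) :* x :=
      (x :* a :+ y :* a′) :* b′ :+ :- ((x :* b :+ y :* b′) :* a′)) refl (X A) (Y A) (X B) (Y B) x y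
    cramer₁ : ∀ x y → bracket A B * y ≡ X A * linear x y B + - (X B * linear x y A)
    cramer₁ x y = solve 6 (λ a a′ b b′ x y → (a :* b′ :+ :- (a′ :* b)) :* y :=
      a :* (x :* b :+ y :* b′) :+ :- (b :* (x :* a :+ y :* a′))) refl (X A) (Y A) (X B) (Y B) x y

  -- The difference form d₀X + d₁Y has the root (d₁, -d₀), which is a point because the two forms
  -- differ.
  linear-root : ∀ l₀ l₁ m₀ m₁ → ¬ (l₀ ≡ m₀ × l₁ ≡ m₁) → ∃[ P ] linear l₀ l₁ P ≡ linear m₀ m₁ P
  linear-root l₀ l₁ m₀ m₁ l≢m with normalise (l₁ + - m₁) (- (l₀ + - m₀))
    (λ (e₁ , e₀) → l≢m (x∙y⁻¹≈ε⇒x≈y _ _ (trans (sym (-‿involutive _)) (trans (cong -_ e₀) -0#≈0#)) , x∙y⁻¹≈ε⇒x≈y _ _ e₁))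
  ... | P , k , k≢0 , ex , ey = P , *-cancelˡ k≢0 (begin
    k * linear l₀ l₁ P                                ≡⟨ scale l₀ l₁ ⟩
    l₀ * (k * X P) + l₁ * (k * Y P)                   ≡⟨ cong₂ (λ x y → l₀ * x + l₁ * y) ex ey ⟨
    l₀ * (l₁ + - m₁) + l₁ * - (l₀ + - m₀)             ≡⟨ solve 4 (λ a b c d → a :* (b :+ :- d) :+ b :* :- (a :+ :- c) :=
                                                           c :* (b :+ :- d) :+ d :* :- (a :+ :- c)) refl l₀ l₁ m₀ m₁ ⟩
    m₀ * (l₁ + - m₁) + m₁ * - (l₀ + - m₀)             ≡⟨ cong₂ (λ x y → m₀ * x + m₁ * y) ex ey ⟩
    m₀ * (k * X P) + m₁ * (k * Y P)                   ≡⟨ scale m₀ m₁ ⟨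
    k * linear m₀ m₁ P                                ∎)
    where
    scale : ∀ x y → k * linear x y P ≡ x * (k * X P) + y * (k * Y P)
    scale x y = solve 5 (λ k a b x y → k :* (x :* a :+ y :* b) := x :* (k :* a) :+ y :* (k :* b)) refl k (X P) (Y P) x y

  open PG6 F

  -- Five vectors of length four are dependent, and a zero coefficient would leave a nontrivial
  -- relation among four independent points.
  five-relation : (p : Fin 5 → Point) → Injective _≡_ _≡_ p →
    ∃[ w ] (∀ i → w i ≢ 0#) × (∀ j → sum (λ i → w i * cubic (p i) j) ≡ 0#)
  five-relation p p-injective with dependent ℕ.≤-refl (cubic ∘ p)
  ... | w , w≢0 , relation = w , (λ i wi≡0 → w≢0 (cubic-relation w p p-injective relation wi≡0)) , relation

  sum₄ : ∀ (t : Fin 4 → Carrier) → sum t ≡ t 0F + t 1F + t 2F + t 3F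
  sum₄ t = solve 4 (λ a b c d → a :+ (b :+ (c :+ (d :+ con (+ 0)))) := a :+ b :+ c :+ d) refl (t 0F) (t 1F) (t 2F) (t 3F)

  -- The scroll in normal form, joining conic and cubic points of equal parameter.

  module Independent (b : Fin 3 → Vec7) (c : Fin 4 → Vec7)
    (bc-independent : ∀ (e : Fin 3 → Carrier) (f : Fin 4 → Carrier) → (∀ x → sum (λ j → e j * b j x) + sum (λ j → f j * c j x) ≡ 0#) →
      (∀ j → e j ≡ 0#) × (∀ j → f j ≡ 0#)) where

    conicPoint cubicPoint : Point → Vec7
    conicPoint P x = sum (λ j → conic P j * b j x)
    cubicPoint P x = sum (λ j → cubic P j * c j x)

    scrollPoint : Carrier → Carrier → Point → Vec7
    scrollPoint l m P x = l * conicPoint P x + m * cubicPoint P x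

    -- Relations on a twisted cubic lying on the scroll.

    module CubicOnScroll (6≤q : 6 ℕ.≤ q) (a : Fin 4 → Vec7)
      (a-independent : ∀ (e : Fin 4 → Carrier) → (∀ x → sum (λ j → e j * a j x) ≡ 0#) → ∀ j → e j ≡ 0#)
      (ℓ μ : Point → Carrier) (base : Point → Point)
      (ℓμ≢0 : ∀ P → ¬ (ℓ P ≡ 0# × μ P ≡ 0#))
      (on-scroll : ∀ P x → sum (λ j → cubic P j * a j x) ≡ scrollPoint (ℓ P) (μ P) (base P) x) where

      distribute : ∀ w l m c d → w * (l * c + m * d) ≡ w * l * c + w * m * d
      distribute = solve 5 (λ w l m c d → w :* (l :* c :+ m :* d) := w :* l :* c :+ w :* m :* d) refl

      module _ {n} (w : Fin n → Carrier) (p : Fin n → Point) where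

        points-split : ∀ x → sum (λ i → w i * sum (λ j → cubic (p i) j * a j x)) ≡
          sum (λ i → w i * ℓ (p i) * conicPoint (base (p i)) x) + sum (λ i → w i * μ (p i) * cubicPoint (base (p i)) x)
        points-split x = begin
          sum (λ i → w i * sum (λ j → cubic (p i) j * a j x))
            ≡⟨ sum-cong-≗ (λ i → trans (cong (w i *_) (on-scroll (p i) x)) (distribute (w i) (ℓ (p i)) (μ (p i)) _ _)) ⟩
          sum (λ i → w i * ℓ (p i) * conicPoint (base (p i)) x + w i * μ (p i) * cubicPoint (base (p i)) x)
            ≡⟨ ∑-distrib-+ (λ i → w i * ℓ (p i) * conicPoint (base (p i)) x) (λ i → w i * μ (p i) * cubicPoint (base (p i)) x) ⟩
          sum (λ i → w i * ℓ (p i) * conicPoint (base (p i)) x) + sum (λ i → w i * μ (p i) * cubicPoint (base (p i)) x) ∎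

        conicSum : Fin 3 → Carrier
        conicSum j = sum (λ i → w i * ℓ (p i) * conic (base (p i)) j)

        cubicSum : Fin 4 → Carrier
        cubicSum j = sum (λ i → w i * μ (p i) * cubic (base (p i)) j)

        curveSum : Fin 4 → Carrier
        curveSum j = sum (λ i → w i * cubic (p i) j)

        curve-split : ∀ x → sum (λ j → curveSum j * a j x) ≡
          sum (λ j → conicSum j * b j x) + sum (λ j → cubicSum j * c j x)
        curve-split x = begin
          sum (λ j → curveSum j * a j x)
            ≡⟨ sum-swap w (cubic ∘ p) (λ j → a j x) ⟨
          sum (λ i → w i * sum (λ j → cubic (p i) j * a j x))
            ≡⟨ points-split x ⟩
          sum (λ i → w i * ℓ (p i) * conicPoint (base (p i)) x) + sum (λ i → w i * μ (p i) * cubicPoint (base (p i)) x)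
            ≡⟨ cong₂ _+_ (sum-swap (λ i → w i * ℓ (p i)) (conic ∘ base ∘ p) (λ j → b j x))
                         (sum-swap (λ i → w i * μ (p i)) (cubic ∘ base ∘ p) (λ j → c j x)) ⟩
          sum (λ j → conicSum j * b j x) + sum (λ j → cubicSum j * c j x) ∎

        -- Substituting scroll coordinates turns a relation on T into a vector of the conic plane
        -- plus a vector of the cubic solid, and these subspaces are independent.
        relation⇒ : (∀ j → curveSum j ≡ 0#) → (∀ j → conicSum j ≡ 0#) × (∀ j → cubicSum j ≡ 0#)
        relation⇒ relation = bc-independent conicSum cubicSum (λ x → trans (sym (curve-split x))
          (sum-zero (λ j → trans (cong (_* a j x) (relation j)) (zeroˡ (a j x)))))

        -- Used to manufacture relations on T: one that is nontrivial but has a zero coefficient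
        -- contradicts `cubic-relation`.
        relation⇐ : (∀ j → conicSum j ≡ 0#) → (∀ j → cubicSum j ≡ 0#) → ∀ j → curveSum j ≡ 0#
        relation⇐ conics cubics = a-independent curveSum (λ x → begin
          sum (λ j → curveSum j * a j x)
            ≡⟨ curve-split x ⟩
          sum (λ j → conicSum j * b j x) + sum (λ j → cubicSum j * c j x)
            ≡⟨ cong₂ _+_ (sum-zero (λ j → trans (cong (_* b j x) (conics j)) (zeroˡ (b j x))))
                         (sum-zero (λ j → trans (cong (_* c j x) (cubics j)) (zeroˡ (c j x)))) ⟩
          0# + 0#
            ≡⟨ +-identityˡ 0# ⟩
          0# ∎)

      inj : ∀ {n} {xs : Vec Point n} → Unique xs → Injective _≡_ _≡_ (lookup xs)
      inj xs! = lookup-injective xs! _ _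

      -- The line has q + 1 ≥ 7 points, so at most six chosen ones leave a fresh one. The implicit
      -- bound is discharged by evaluation.
      another : ∀ {k} {xs : Vec Point k} {k≤6 : True (k ℕ.≤? 6)} → Unique xs → ∃[ y ] Unique (y ∷ xs)
      another {k≤6 = k≤6} = extend (ℕ.s≤s (ℕ.≤-trans (toWitness k≤6) 6≤q))

      -- Four points of T in the conic plane would be dependent, while four points of a twisted
      -- cubic are not. `R` brings the count to the five points that `cubic-relation` expects.
      μ-not-all-zero : ∀ {R} {xs : Vec Point 4} → Unique (R ∷ xs) → ¬ (∀ i → μ (lookup xs i) ≡ 0#)
      μ-not-all-zero {R} {xs} R∷xs! μ≡0 with dependent ℕ.≤-refl v
        where
        v : Fin 5 → Fin 4 → Carrier
        v i       0F = ℓ (lookup (R ∷ xs) i) * conic (base (lookup (R ∷ xs) i)) 0F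
        v i       1F = ℓ (lookup (R ∷ xs) i) * conic (base (lookup (R ∷ xs) i)) 1F
        v i       2F = ℓ (lookup (R ∷ xs) i) * conic (base (lookup (R ∷ xs) i)) 2F
        -- The last column is the indicator of `R`; it forces the coefficient of `R` to vanish, so
        -- the dependence lives on the four points of `xs`.
        v 0F      3F = 1#
        v (suc _) 3F = 0#
      ... | d , d≢0 , dependence = d≢0 (cubic-relation d p (inj R∷xs!) (relation⇐ d p conics cubics) d₀≡0)
        where
        p = lookup (R ∷ xs)
        d₀≡0 : d 0F ≡ 0#
        d₀≡0 = trans (solve 5 (λ a b c d e → a := a :* con (+ 1) :+ (b :* con (+ 0) :+ (c :* con (+ 0) :+
          (d :* con (+ 0) :+ (e :* con (+ 0) :+ con (+ 0)))))) refl (d 0F) (d 1F) (d 2F) (d 3F) (d 4F)) (dependence 3F)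
        assoc : ∀ j → sum (λ i → d i * (ℓ (p i) * conic (base (p i)) j)) ≡ 0# →
          sum (λ i → d i * ℓ (p i) * conic (base (p i)) j) ≡ 0#
        assoc j = trans (sum-cong-≗ (λ i → *-assoc (d i) (ℓ (p i)) (conic (base (p i)) j)))
        conics : ∀ j → sum (λ i → d i * ℓ (p i) * conic (base (p i)) j) ≡ 0#
        conics 0F = assoc 0F (dependence 0F)
        conics 1F = assoc 1F (dependence 1F)
        conics 2F = assoc 2F (dependence 2F)
        dμ≡0 : ∀ i → d i * μ (p i) ≡ 0#
        dμ≡0 0F      = trans (cong (_* μ R) d₀≡0) (zeroˡ _)
        dμ≡0 (suc i) = trans (cong (d (suc i) *_) (μ≡0 i)) (zeroʳ _)
        cubics : ∀ j → sum (λ i → d i * μ (p i) * cubic (base (p i)) j) ≡ 0#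
        cubics j = sum-zero (λ i → trans (cong (_* cubic (base (p i)) j) (dμ≡0 i)) (zeroˡ _))

      -- No three points of a twisted cubic are collinear. The columns ℓ and μ relate the three
      -- points inside their common line; `B` and `C` pad the list to five, and their indicator
      -- columns force their coefficients to zero.
      no-three-on-generator : ∀ {P Q R} → Unique (P ∷ Q ∷ R ∷ []) → ∀ {h} →
        base P ≡ h → base Q ≡ h → base R ≡ h → ⊥
      no-three-on-generator {P} {Q} {R} PQR! {h} hP hQ hR with another PQR!
      ... | B , BPQR! with another BPQR!
      ... | C , CBPQR! with dependent ℕ.≤-refl v
        where
        v : Fin 5 → Fin 4 → Carrier
        v i             0F = ℓ (lookup (C ∷ B ∷ P ∷ Q ∷ R ∷ []) i)
        v i             1F = μ (lookup (C ∷ B ∷ P ∷ Q ∷ R ∷ []) i)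
        v 0F            2F = 1#
        v (suc _)       2F = 0#
        v 1F            3F = 1#
        v 0F            3F = 0#
        v (suc (suc _)) 3F = 0#
      ... | d , d≢0 , dependence = d≢0 (cubic-relation d p (inj CBPQR!)
        (relation⇐ d p (λ j → collapse ℓ (dependence 0F) (λ A → conic A j)) (λ j → collapse μ (dependence 1F) (λ A → cubic A j))) d₀≡0)
        where
        p = lookup (C ∷ B ∷ P ∷ Q ∷ R ∷ [])
        d₀≡0 : d 0F ≡ 0#
        d₀≡0 = trans (solve 5 (λ a b c d e → a := a :* con (+ 1) :+ (b :* con (+ 0) :+ (c :* con (+ 0) :+
          (d :* con (+ 0) :+ (e :* con (+ 0) :+ con (+ 0)))))) refl (d 0F) (d 1F) (d 2F) (d 3F) (d 4F)) (dependence 2F)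
        d₁≡0 : d 1F ≡ 0#
        d₁≡0 = trans (solve 5 (λ a b c d e → b := a :* con (+ 0) :+ (b :* con (+ 1) :+ (c :* con (+ 0) :+
          (d :* con (+ 0) :+ (e :* con (+ 0) :+ con (+ 0)))))) refl (d 0F) (d 1F) (d 2F) (d 3F) (d 4F)) (dependence 3F)
        collapse : ∀ (t : Point → Carrier) → sum (λ i → d i * t (p i)) ≡ 0# →
          ∀ (g : Point → Carrier) → sum (λ i → d i * t (p i) * g (base (p i))) ≡ 0#
        collapse t Σ≡0 g = begin
          sum (λ i → d i * t (p i) * g (base (p i)))     ≡⟨ sum-cong-≗ same ⟩
          sum (λ i → d i * t (p i) * g h)                ≡⟨ *-distribʳ-sum (g h) (λ i → d i * t (p i)) ⟨
          sum (λ i → d i * t (p i)) * g h                ≡⟨ cong (_* g h) Σ≡0 ⟩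
          0# * g h                                       ≡⟨ zeroˡ _ ⟩
          0#                                             ∎
          where
          vanishing : ∀ {i u v} → d i ≡ 0# → d i * t (p i) * u ≡ d i * t (p i) * v
          vanishing {i} {u} {v} di≡0 rewrite di≡0 =
            solve 3 (λ t u v → con (+ 0) :* t :* u := con (+ 0) :* t :* v) refl (t (p i)) u v
          same : ∀ i → d i * t (p i) * g (base (p i)) ≡ d i * t (p i) * g h
          same 0F = vanishing d₀≡0
          same 1F = vanishing d₁≡0
          same 2F = cong (λ A → d 2F * t P * g A) hP
          same 3F = cong (λ A → d 3F * t Q * g A) hQ
          same 4F = cong (λ A → d 4F * t R * g A) hR

      -- A quadratic form with roots `A`, `B` and a cubic form with the same roots would isolate
      -- point `j` in the conic relation and in the cubic relation, so both of its coordinates on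
      -- its generator would vanish.
      not-isolated : ∀ {xs : Vec Point 5} → Unique xs → ∀ j {A B} →
        base (lookup xs j) ≢ A → base (lookup xs j) ≢ B →
        ¬ (∀ i → i ≢ j → base (lookup xs i) ≡ A ⊎ base (lookup xs i) ≡ B)
      not-isolated {xs} xs! j j≢A j≢B others =
        let w , w≢0 , relation = five-relation p (inj xs!)
            conics , cubics = relation⇒ w p relation
        in ℓμ≢0 (p j)
          ( *-zero-cancelˡ (w≢0 j) (conic-isolate (λ i → w i * ℓ (p i)) (base ∘ p) conics j j≢A j≢B
              (λ i i≢j → inj₂ (others i i≢j)))
          , *-zero-cancelˡ (w≢0 j) (cubic-isolate (λ i → w i * μ (p i)) (base ∘ p) cubics j j≢A j≢B j≢B
              (λ i i≢j → inj₂ ([ inj₁ , inj₂ ∘ inj₁ ]′ (others i i≢j)))))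
        where
        p = lookup xs

      -- Three roots are too many for a nonzero quadratic form, so only the cubic relation isolates
      -- point `j`; what remains is that this point lies in the conic plane.
      isolated⇒μ≡0 : ∀ {xs : Vec Point 5} → Unique xs → ∀ j {A B C} →
        base (lookup xs j) ≢ A → base (lookup xs j) ≢ B → base (lookup xs j) ≢ C →
        (∀ i → i ≢ j → base (lookup xs i) ≡ A ⊎ base (lookup xs i) ≡ B ⊎ base (lookup xs i) ≡ C) →
        μ (lookup xs j) ≡ 0#
      isolated⇒μ≡0 {xs} xs! j j≢A j≢B j≢C others =
        let w , w≢0 , relation = five-relation p (inj xs!)
            _ , cubics = relation⇒ w p relation
        in *-zero-cancelˡ (w≢0 j) (cubic-isolate (λ i → w i * μ (p i)) (base ∘ p) cubics j j≢A j≢B j≢C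
             (λ i i≢j → inj₂ (others i i≢j)))
        where
        p = lookup xs

      -- Excluding two points of T on one generator.

      module SharedGenerator {P P′} (P′P! : Unique (P′ ∷ P ∷ [])) (shared : base P′ ≡ base P) where

        off : ∀ {A} → Unique (A ∷ P′ ∷ P ∷ []) → base A ≢ base P
        off A! e = no-three-on-generator A! e shared refl

        -- If `A` and `B` also shared a generator, then `A`, `B`, `P′`, `P` would occupy only two
        -- generators, and a fifth point, which lies on neither since no three points share one,
        -- would be isolated.
        apart : ∀ {A B} → Unique (B ∷ A ∷ P′ ∷ P ∷ []) → base B ≢ base A
        apart {A} {B} BA!@(_ ∷ A!) e with another BA!
        ... | C , C!@((c≢b ∷ c≢a ∷ c≢p′ ∷ c≢p ∷ []) ∷ (b≢a ∷ _) ∷ _) =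
          not-isolated C! 0F {base A} {base P} C≢A (off ((c≢p′ ∷ c≢p ∷ []) ∷ P′P!)) others
          where
          C≢A : base C ≢ base A
          C≢A e′ = no-three-on-generator (take⁺ 3 C!) e′ e refl
          others : ∀ i → i ≢ 0F → base (lookup (C ∷ B ∷ A ∷ P′ ∷ P ∷ []) i) ≡ base A ⊎
            base (lookup (C ∷ B ∷ A ∷ P′ ∷ P ∷ []) i) ≡ base P
          others 0F 0≢0 = ⊥-elim (0≢0 refl)
          others 1F _   = inj₁ e
          others 2F _   = inj₁ refl
          others 3F _   = inj₂ shared
          others 4F _   = inj₂ refl

        -- Two fresh points and the pair `P′`, `P` occupy three generators, all different from that
        -- of `A`, so a cubic form isolates `A`.
        μ≡0 : ∀ {A} → Unique (A ∷ P′ ∷ P ∷ []) → μ A ≡ 0#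
        μ≡0 {A} A! with another A!
        ... | B , BA! with another BA!
        ... | C , C!@((_ ∷ c≢a ∷ c≢p′ ∷ c≢p ∷ []) ∷ _) =
          isolated⇒μ≡0 C! 2F {base C} {base B} {base P}
            (apart ((c≢a ∷ c≢p′ ∷ c≢p ∷ []) ∷ A!) ∘ sym) (apart BA! ∘ sym) (off A!) others
          where
          others : ∀ i → i ≢ 2F → base (lookup (C ∷ B ∷ A ∷ P′ ∷ P ∷ []) i) ≡ base C ⊎
            base (lookup (C ∷ B ∷ A ∷ P′ ∷ P ∷ []) i) ≡ base B ⊎
            base (lookup (C ∷ B ∷ A ∷ P′ ∷ P ∷ []) i) ≡ base P
          others 0F _   = inj₁ refl
          others 1F _   = inj₂ (inj₁ refl)
          others 2F 2≢2 = ⊥-elim (2≢2 refl)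
          others 3F _   = inj₂ (inj₂ shared)
          others 4F _   = inj₂ (inj₂ refl)

        -- All points of T other than `P` and `P′` now lie in the conic plane; four of them are
        -- already too many.
        impossible : ⊥
        impossible with another P′P!
        ... | A , A! with another A!
        ... | B , B!@((_ ∷ bp) ∷ _) with another B!
        ... | C , C!@((_ ∷ _ ∷ cp) ∷ _) with another C!
        ... | D , D!@((_ ∷ _ ∷ _ ∷ dp) ∷ _) =
          -- The fifth parameter need only differ from the four, so `P` and `P′` are dropped before
          -- it is chosen.
          μ-not-all-zero (proj₂ (another (take⁺ 4 D!))) zeros
          where
          zeros : ∀ i → μ (lookup (D ∷ C ∷ B ∷ A ∷ []) i) ≡ 0#
          zeros 0F = μ≡0 (dp ∷ P′P!)
          zeros 1F = μ≡0 (cp ∷ P′P!)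
          zeros 2F = μ≡0 (bp ∷ P′P!)
          zeros 3F = μ≡0 A!

      -- The twisted cubic is a section.

      base-injective : Injective _≡_ _≡_ base
      base-injective {P} {P′} e = decidable-stable (P Fin.≟ P′) (λ P≢P′ →
        SharedGenerator.impossible (((P≢P′ ∘ sym) ∷ []) ∷ [] ∷ []) (sym e))

      -- Since `base` is injective, the cubic relation runs over five distinct points. If the
      -- coefficient at `P` (position `4F`) were zero, all five would be, which puts five points of
      -- T in the conic plane.
      μ≢0 : ∀ P → μ P ≢ 0#
      μ≢0 P μP≡0 with another {xs = P ∷ []} ([] ∷ [])
      ... | A , A! with another A!
      ... | B , B! with another B!
      ... | C , C! with another C!
      ... | D , D! = let w , w≢0 , relation = five-relation p (inj D!)
                         _ , cubics = relation⇒ w p relation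
                         wμ≡0 = cubic-relation (λ i → w i * μ (p i)) (base ∘ p) (inj D! ∘ base-injective) cubics {4F}
                           (trans (cong (w 4F *_) μP≡0) (zeroʳ (w 4F)))
                     in μ-not-all-zero D! (λ i → *-zero-cancelˡ (w≢0 (suc i)) (wμ≡0 (suc i)))
        where
        p = lookup (D ∷ C ∷ B ∷ A ∷ P ∷ [])

      -- Subtracting the sheared cubic relation from the conic relation cancels its terms at A and B.
      collinear : ∀ {A B P} → Unique (P ∷ B ∷ A ∷ []) → ∀ l₀ l₁ →
        ℓ A ≡ linear l₀ l₁ (base A) * μ A → ℓ B ≡ linear l₀ l₁ (base B) * μ B →
        ℓ P ≡ linear l₀ l₁ (base P) * μ P
      collinear {A} {B} {P} P! l₀ l₁ eA eB with another P!
      ... | C , C! with another C!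
      -- Position `2F` holds `P`. The hypotheses kill the terms of `B` and `A`, and the quadratic
      -- form with roots at `base D` and `base C` removes the other two.
      ... | D , D! = x∙y⁻¹≈ε⇒x≈y _ _ (*-zero-cancelˡ (w≢0 2F)
            (conic-isolate u (base ∘ p) sheared 2F (distinct {2F} {0F} λ ()) (distinct {2F} {1F} λ ()) others))
        where
        p = lookup (D ∷ C ∷ P ∷ B ∷ A ∷ [])
        relation₅ = five-relation p (inj D!)
        w = proj₁ relation₅
        w≢0 = proj₁ (proj₂ relation₅)
        relation = relation⇒ w p (proj₂ (proj₂ relation₅))
        lin = linear l₀ l₁
        u : Fin 5 → Carrier
        u i = w i * (ℓ (p i) + - (lin (base (p i)) * μ (p i)))
        distinct : ∀ {i j} → i ≢ j → base (p i) ≢ base (p j)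
        distinct i≢j e = i≢j (inj D! (base-injective e))
        -- A linear form times a quadratic monomial is a cubic form, so the cubic relation
        -- annihilates it; `k` lists its coefficients.
        product : ∀ j → sum (λ i → w i * μ (p i) * (lin (base (p i)) * conic (base (p i)) j)) ≡ 0#
        product j = trans (sum-cong-≗ (λ i → cong (w i * μ (p i) *_) (expand (base (p i)) j)))
          (sum-annihilate (λ i → w i * μ (p i)) (cubic ∘ base ∘ p) (k j) (proj₂ relation))
          where
          k : Fin 3 → Fin 4 → Carrier
          k 0F 0F = l₀
          k 0F 1F = l₁
          k 1F 1F = l₀
          k 1F 2F = l₁
          k 2F 2F = l₀
          k 2F 3F = l₁
          k _  _  = 0#
          expand : ∀ Q j → lin Q * conic Q j ≡ sum (λ m → cubic Q m * k j m)
          expand Q 0F = solve 4 (λ x y l m → (l :* x :+ m :* y) :* (x :* x) := x :* x :* x :* l :+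
            (x :* x :* y :* m :+ (x :* y :* y :* con (+ 0) :+ (y :* y :* y :* con (+ 0) :+ con (+ 0))))) refl (X Q) (Y Q) l₀ l₁
          expand Q 1F = solve 4 (λ x y l m → (l :* x :+ m :* y) :* (x :* y) := x :* x :* x :* con (+ 0) :+
            (x :* x :* y :* l :+ (x :* y :* y :* m :+ (y :* y :* y :* con (+ 0) :+ con (+ 0))))) refl (X Q) (Y Q) l₀ l₁
          expand Q 2F = solve 4 (λ x y l m → (l :* x :+ m :* y) :* (y :* y) := x :* x :* x :* con (+ 0) :+
            (x :* x :* y :* con (+ 0) :+ (x :* y :* y :* l :+ (y :* y :* y :* m :+ con (+ 0))))) refl (X Q) (Y Q) l₀ l₁
        sheared : ∀ j → sum (λ i → u i * conic (base (p i)) j) ≡ 0#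
        sheared j = begin
          sum (λ i → u i * conic (base (p i)) j)
            ≡⟨ sum-cong-≗ (λ i → solve 5 (λ w l n m c → w :* (l :+ :- (n :* m)) :* c :=
                 w :* l :* c :+ con (-[1+ 0 ]) :* (w :* m :* (n :* c))) refl
                 (w i) (ℓ (p i)) (lin (base (p i))) (μ (p i)) (conic (base (p i)) j)) ⟩
          sum (λ i → s i + - 1# * t i)
            ≡⟨ ∑-distrib-+ s (λ i → - 1# * t i) ⟩
          sum s + sum (λ i → - 1# * t i)
            ≡⟨ cong₂ _+_ (proj₁ relation j) (sym (*-distribˡ-sum (- 1#) t)) ⟩
          0# + - 1# * sum t
            ≡⟨ cong (λ z → 0# + - 1# * z) (product j) ⟩
          0# + - 1# * 0#
            ≡⟨ trans (+-identityˡ _) (zeroʳ _) ⟩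
          0# ∎
          where
          s t : Fin 5 → Carrier
          s i = w i * ℓ (p i) * conic (base (p i)) j
          t i = w i * μ (p i) * (lin (base (p i)) * conic (base (p i)) j)
        u≡0 : ∀ i → ℓ (p i) ≡ lin (base (p i)) * μ (p i) → u i ≡ 0#
        u≡0 i e = trans (cong (w i *_) (x≈y⇒x∙y⁻¹≈ε e)) (zeroʳ (w i))
        others : ∀ i → i ≢ 2F → u i ≡ 0# ⊎ base (p i) ≡ base D ⊎ base (p i) ≡ base C
        others 0F _   = inj₂ (inj₁ refl)
        others 1F _   = inj₂ (inj₂ refl)
        others 2F 2≢2 = ⊥-elim (2≢2 refl)
        others 3F _   = inj₁ (u≡0 3F eB)
        others 4F _   = inj₁ (u≡0 4F eA)

      section-through : ∀ {A B} → Unique (B ∷ A ∷ []) → ∀ l₀ l₁ →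
        ℓ A ≡ linear l₀ l₁ (base A) * μ A → ℓ B ≡ linear l₀ l₁ (base B) * μ B → ∀ P x →
        sum (λ j → cubic P j * a j x) ≡ μ P * scrollPoint (linear l₀ l₁ (base P)) 1# (base P) x
      section-through {A} {B} B! l₀ l₁ eA eB P x = begin
        sum (λ j → cubic P j * a j x)
          ≡⟨ on-scroll P x ⟩
        ℓ P * conicPoint (base P) x + μ P * cubicPoint (base P) x
          ≡⟨ cong (λ z → z * conicPoint (base P) x + μ P * cubicPoint (base P) x) (ratio P) ⟩
        linear l₀ l₁ (base P) * μ P * conicPoint (base P) x + μ P * cubicPoint (base P) x
          ≡⟨ factor (linear l₀ l₁ (base P)) (μ P) _ _ ⟩
        μ P * scrollPoint (linear l₀ l₁ (base P)) 1# (base P) x ∎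
        where
        factor : ∀ n m c d → n * m * c + m * d ≡ m * (n * c + 1# * d)
        factor = solve 4 (λ n m c d → n :* m :* c :+ m :* d := m :* (n :* c :+ con (+ 1) :* d)) refl
        ratio : ∀ P → ℓ P ≡ linear l₀ l₁ (base P) * μ P
        ratio P with P Fin.≟ A | P Fin.≟ B
        ... | yes refl | _        = eA
        ... | no _     | yes refl = eB
        ... | no P≢A   | no P≢B   = collinear ((P≢B ∷ P≢A ∷ []) ∷ B!) l₀ l₁ eA eB

      -- The form interpolates the ratio ℓ/μ at two parameters: the ratio exists because μ never
      -- vanishes, and interpolation works because `base` separates the parameters.
      section : ∃[ l₀ ] ∃[ l₁ ] ∀ P x →
        sum (λ j → cubic P j * a j x) ≡ μ P * scrollPoint (linear l₀ l₁ (base P)) 1# (base P) x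
      section =
        let B , B! = another {xs = 0F ∷ []} ([] ∷ [])
            r , μr≡1 = inverse (μ 0F) (μ≢0 0F)
            s , μs≡1 = inverse (μ B) (μ≢0 B)
            l₀ , l₁ , eA , eB = interpolate (distinct B! ∘ base-injective) (ℓ 0F * r) (ℓ B * s)
        in l₀ , l₁ , section-through B! l₀ l₁ (value μr≡1 eA) (value μs≡1 eB)
        where
        distinct : ∀ {A B} → Unique (B ∷ A ∷ []) → A ≢ B
        distinct ((B≢A ∷ []) ∷ _) = B≢A ∘ sym
        value : ∀ {t l m r} → m * r ≡ 1# → t ≡ l * r → l ≡ t * m
        value {t} {l} {m} {r} mr≡1 refl = begin
          l            ≡⟨ *-identityʳ l ⟨
          l * 1#       ≡⟨ cong (l *_) mr≡1 ⟨
          l * (m * r)  ≡⟨ solve 3 (λ l m r → l :* (m :* r) := l :* r :* m) refl l m r ⟩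
          l * r * m    ∎

      -- Needed for the converse inclusion: the section must not contain points on generators that T
      -- misses.
      base-surjective : ∀ h → ∃[ P ] base P ≡ h
      base-surjective = surjective base-injective

    -- Uniqueness of coordinates on the scroll.

    -- In the cubic solid the equality reads m·cubic P = m′·cubic Q; two distinct points of the
    -- cubic are independent, so `P ≢ Q` would force `m ≡ 0#`. Once the parameters agree, the
    -- coefficients can be compared.
    scrollPoint-injective : ∀ {l m l′ m′ P Q} → m ≢ 0# →
      (∀ x → scrollPoint l m P x ≡ scrollPoint l′ m′ Q x) → P ≡ Q × l ≡ l′ × m ≡ m′
    scrollPoint-injective {l} {m} {l′} {m′} {P} {Q} m≢0 same = P≡Q , l≡l′ P≡Q , m≡m′ P≡Q
      where
      e : Fin 3 → Carrier
      e j = l * conic P j + - (l′ * conic Q j)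
      f : Fin 4 → Carrier
      f j = m * cubic P j + - (m′ * cubic Q j)
      regroup : ∀ {n} (u v : Fin n → Carrier) (k : Fin n → Carrier) l l′ →
        sum (λ j → (l * u j + - (l′ * v j)) * k j) ≡ l * sum (λ j → u j * k j) + - l′ * sum (λ j → v j * k j)
      regroup u v k l l′ = begin
        sum (λ j → (l * u j + - (l′ * v j)) * k j)
          ≡⟨ sum-cong-≗ (λ j → solve 5 (λ l l′ u v k → (l :* u :+ :- (l′ :* v)) :* k :=
               l :* (u :* k) :+ (:- l′) :* (v :* k)) refl l l′ (u j) (v j) (k j)) ⟩
        sum (λ j → l * (u j * k j) + - l′ * (v j * k j))
          ≡⟨ ∑-distrib-+ (λ j → l * (u j * k j)) (λ j → - l′ * (v j * k j)) ⟩
        sum (λ j → l * (u j * k j)) + sum (λ j → - l′ * (v j * k j))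
          ≡⟨ cong₂ _+_ (*-distribˡ-sum l (λ j → u j * k j)) (*-distribˡ-sum (- l′) (λ j → v j * k j)) ⟨
        l * sum (λ j → u j * k j) + - l′ * sum (λ j → v j * k j) ∎
      difference : ∀ A B C D → l * A + m * B ≡ l′ * C + m′ * D →
        (l * A + - l′ * C) + (m * B + - m′ * D) ≡ 0#
      difference A B C D eq = begin
        (l * A + - l′ * C) + (m * B + - m′ * D)
          ≡⟨ solve 8 (λ l m l′ m′ A B C D → (l :* A :+ (:- l′) :* C) :+ (m :* B :+ (:- m′) :* D) :=
               (l :* A :+ m :* B) :+ :- (l′ :* C :+ m′ :* D)) refl l m l′ m′ A B C D ⟩
        (l * A + m * B) + - (l′ * C + m′ * D)
          ≡⟨ x≈y⇒x∙y⁻¹≈ε eq ⟩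
        0# ∎
      ef≡0 : (∀ j → e j ≡ 0#) × (∀ j → f j ≡ 0#)
      ef≡0 = bc-independent e f (λ x → trans
        (cong₂ _+_ (regroup (conic P) (conic Q) (λ j → b j x) l l′) (regroup (cubic P) (cubic Q) (λ j → c j x) m m′))
        (difference (conicPoint P x) (cubicPoint P x) (conicPoint Q x) (cubicPoint Q x) (same x)))
      pair : Point → Point → Fin 2 → Point
      pair A B 0F = A
      pair A B 1F = B
      weights : Fin 2 → Carrier
      weights 0F = m
      weights 1F = - m′
      P≡Q : P ≡ Q
      P≡Q = decidable-stable (P Fin.≟ Q) (λ P≢Q → m≢0 (cubic-isolate weights (pair P Q)
        (λ j → trans (solve 4 (λ m m′ u v → m :* u :+ ((:- m′) :* v :+ con (+ 0)) := m :* u :+ :- (m′ :* v)) refl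
                        m m′ (cubic P j) (cubic Q j))
                     (proj₂ ef≡0 j))
        0F P≢Q P≢Q P≢Q others))
        where
        others : ∀ i → i ≢ 0F → weights i ≡ 0# ⊎ pair P Q i ≡ Q ⊎ pair P Q i ≡ Q ⊎ pair P Q i ≡ Q
        others 0F 0≢0 = ⊥-elim (0≢0 refl)
        others 1F _   = inj₂ (inj₁ refl)
      -- Each representative has a coordinate equal to 1, whose power is the entry to compare: the
      -- last one for `zero`, the first one for `suc t`.
      cancel₂ : ∀ P {l l′} → (∀ j → l * conic P j ≡ l′ * conic P j) → l ≡ l′
      cancel₂ zero    {l} {l′} eq = trans (unit l) (trans (eq 2F) (sym (unit l′)))
        where unit = solve 1 (λ l → l := l :* (con (+ 1) :* con (+ 1))) refl
      cancel₂ (suc t) {l} {l′} eq = trans (unit l) (trans (eq 0F) (sym (unit l′)))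
        where unit = solve 1 (λ l → l := l :* (con (+ 1) :* con (+ 1))) refl
      cancel₃ : ∀ P {l l′} → (∀ j → l * cubic P j ≡ l′ * cubic P j) → l ≡ l′
      cancel₃ zero    {l} {l′} eq = trans (unit l) (trans (eq 3F) (sym (unit l′)))
        where unit = solve 1 (λ l → l := l :* (con (+ 1) :* con (+ 1) :* con (+ 1))) refl
      cancel₃ (suc t) {l} {l′} eq = trans (unit l) (trans (eq 0F) (sym (unit l′)))
        where unit = solve 1 (λ l → l := l :* (con (+ 1) :* con (+ 1) :* con (+ 1))) refl
      l≡l′ : P ≡ Q → l ≡ l′
      l≡l′ refl = cancel₂ P (λ j → x∙y⁻¹≈ε⇒x≈y _ _ (proj₁ ef≡0 j))
      m≡m′ : P ≡ Q → m ≡ m′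
      m≡m′ refl = cancel₃ P (λ j → x∙y⁻¹≈ε⇒x≈y _ _ (proj₂ ef≡0 j))

    -- The zero vector has coordinates 0 and 0, so uniqueness of coordinates would give `m ≡ 0#`.
    scrollPoint-nonzero : ∀ {l m} P → m ≢ 0# → NonZero (scrollPoint l m P)
    scrollPoint-nonzero {l} {m} P m≢0 zero-point = m≢0 (proj₂ (proj₂ (scrollPoint-injective {l′ = 0#} {0#} {P} {P} m≢0
      (λ x → trans (zero-point x) (sym (null (conicPoint P x) (cubicPoint P x)))))))
      where
      null : ∀ u v → 0# * u + 0# * v ≡ 0#
      null = solve 2 (λ u v → con (+ 0) :* u :+ con (+ 0) :* v := con (+ 0)) refl

    -- Sections of the scroll and the twisted cubics that they are.

    sectionPoint : Carrier → Carrier → Point → Vec7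
    sectionPoint l₀ l₁ P = scrollPoint (linear l₀ l₁ P) 1# P

    OnSection : Carrier → Carrier → Vec7 → Set
    OnSection l₀ l₁ y = ∃[ P ] ∃[ k ] (k ≢ 0# × (∀ x → y x ≡ k * sectionPoint l₀ l₁ P x))

    OnScroll : Vec7 → Set
    OnScroll y = ∃[ P ] ∃[ l ] ∃[ m ] (¬ (l ≡ 0# × m ≡ 0#) × (∀ x → y x ≡ scrollPoint l m P x))

    scale-section : ∀ k n P x → k * scrollPoint n 1# P x ≡ scrollPoint (k * n) k P x
    scale-section k n P x = go k n (conicPoint P x) (cubicPoint P x)
      where
      go : ∀ k n u v → k * (n * u + 1# * v) ≡ k * n * u + k * v
      go = solve 4 (λ k n u v → k :* (n :* u :+ con (+ 1) :* v) := k :* n :* u :+ k :* v) refl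

    onSection⇒onScroll : ∀ {l₀ l₁ y} → OnSection l₀ l₁ y → OnScroll y
    onSection⇒onScroll (P , k , k≢0 , eq) =
      P , k * linear _ _ P , k , (λ (_ , k≡0) → k≢0 k≡0) , λ x → trans (eq x) (scale-section k _ P x)

    onSection-coordinates : ∀ {l₀ l₁ y l m} P → m ≢ 0# → (∀ x → y x ≡ scrollPoint l m P x) →
      OnSection l₀ l₁ y → l ≡ m * linear l₀ l₁ P
    onSection-coordinates {l₀} {l₁} {y} {l} {m} P m≢0 y≡ (Q , k , k≢0 , eq) =
      conclude (scrollPoint-injective {l} {m} {k * linear l₀ l₁ Q} {k} {P} {Q} m≢0
        (λ x → trans (sym (y≡ x)) (trans (eq x) (scale-section k _ Q x))))
      where
      conclude : P ≡ Q × l ≡ k * linear l₀ l₁ Q × m ≡ k → l ≡ m * linear l₀ l₁ P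
      conclude (refl , l≡ , refl) = l≡

    curvePoint : TwistedCubic → Point → Vec7
    curvePoint T P = TwistedCubic.param T (X P) (Y P)

    -- An equality of point sets only: the parametrisation of T is not compared with that of the
    -- section.
    CutsSection : TwistedCubic → Carrier → Carrier → Set
    CutsSection T l₀ l₁ = ∀ y → (points T y → OnSection l₀ l₁ y) × (OnSection l₀ l₁ y → points T y)

    coefficients : TwistedCubic → Fin 4 → Vec7
    coefficients T 0F = TwistedCubic.a₀ T
    coefficients T 1F = TwistedCubic.a₁ T
    coefficients T 2F = TwistedCubic.a₂ T
    coefficients T 3F = TwistedCubic.a₃ T

    coefficients-independent : ∀ T (e : Fin 4 → Carrier) →
      (∀ x → sum (λ j → e j * coefficients T j x) ≡ 0#) → ∀ j → e j ≡ 0#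
    coefficients-independent T e eq = each (TwistedCubic.indep T (e 0F) (e 1F) (e 2F) (e 3F)
      (λ x → trans (sym (sum₄ (λ j → e j * coefficients T j x))) (eq x)))
      where
      each : e 0F ≡ 0# × e 1F ≡ 0# × e 2F ≡ 0# × e 3F ≡ 0# → ∀ j → e j ≡ 0#
      each (e₀ , _ , _ , _) 0F = e₀
      each (_ , e₁ , _ , _) 1F = e₁
      each (_ , _ , e₂ , _) 2F = e₂
      each (_ , _ , _ , e₃) 3F = e₃

    curvePoint-nonzero : ∀ T P → NonZero (curvePoint T P)
    curvePoint-nonzero T P eq = XY≢0 P (root (cubic≡0 0F) , root (cubic≡0 3F))
      where
      cubic≡0 : ∀ j → cubic P j ≡ 0#
      cubic≡0 = coefficients-independent T (cubic P) (λ x → trans (sum₄ (λ j → cubic P j * coefficients T j x)) (eq x))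
      root : ∀ {z} → z * z * z ≡ 0# → z ≡ 0#
      root {z} eq = decidable-stable (z ≟ 0#) (λ z≢0 → *-nonzero (*-nonzero z≢0 z≢0) z≢0 eq)

    curvePoint-onCurve : ∀ T P {k} {y : Vec7} → k ≢ 0# → (∀ x → curvePoint T P x ≡ k * y x) → points T y
    curvePoint-onCurve T P {k} k≢0 eq = X P , Y P , XY≢0 P , k , k≢0 , eq

    divide : ∀ {k} → k ≢ 0# → ∃[ r ] (r ≢ 0# × (∀ {y z} → k * y ≡ z → y ≡ r * z))
    divide {k} k≢0 = let r , kr≡1 = inverse k k≢0 in r ,
      (λ r≡0 → 0≢1 (trans (sym (zeroʳ k)) (trans (cong (k *_) (sym r≡0)) kr≡1))) ,
      λ {y} {z} ky≡z → begin
        y            ≡⟨ *-identityˡ y ⟨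
        1# * y       ≡⟨ cong (_* y) kr≡1 ⟨
        k * r * y    ≡⟨ solve 3 (λ k r y → k :* r :* y := r :* (k :* y)) refl k r y ⟩
        r * (k * y)  ≡⟨ cong (r *_) ky≡z ⟩
        r * z        ∎

    param-scale : ∀ T k P x → TwistedCubic.param T (k * X P) (k * Y P) x ≡ k * k * k * curvePoint T P x
    param-scale T k P x = solve 7 (λ k s t a b c d →
      k :* s :* (k :* s) :* (k :* s) :* a :+ k :* s :* (k :* s) :* (k :* t) :* b :+
      k :* s :* (k :* t) :* (k :* t) :* c :+ k :* t :* (k :* t) :* (k :* t) :* d :=
      k :* k :* k :* (s :* s :* s :* a :+ s :* s :* t :* b :+ s :* t :* t :* c :+ t :* t :* t :* d)) refl
      k (X P) (Y P) (TwistedCubic.a₀ T x) (TwistedCubic.a₁ T x) (TwistedCubic.a₂ T x) (TwistedCubic.a₃ T x)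

    onCurve⇒curvePoint : ∀ T {y} → points T y → ∃[ P ] ∃[ k ] (k ≢ 0# × (∀ x → y x ≡ k * curvePoint T P x))
    onCurve⇒curvePoint T {y} (s , t , st≢0 , k , k≢0 , eq) = from-normalised (normalise s t st≢0) (divide k≢0)
      where
      from-normalised : ∃[ P ] ∃[ n ] (n ≢ 0# × s ≡ n * X P × t ≡ n * Y P) →
        ∃[ r ] (r ≢ 0# × (∀ {y z} → k * y ≡ z → y ≡ r * z)) →
        ∃[ P ] ∃[ k ] (k ≢ 0# × (∀ x → y x ≡ k * curvePoint T P x))
      from-normalised (P , n , n≢0 , refl , refl) (r , r≢0 , solve-k) =
        P , r * (n * n * n) , *-nonzero r≢0 (*-nonzero (*-nonzero n≢0 n≢0) n≢0) , λ x → begin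
          y x                                ≡⟨ solve-k (sym (eq x)) ⟩
          r * TwistedCubic.param T s t x     ≡⟨ cong (r *_) (param-scale T n P x) ⟩
          r * (n * n * n * curvePoint T P x) ≡⟨ *-assoc r (n * n * n) (curvePoint T P x) ⟨
          r * (n * n * n) * curvePoint T P x ∎

    cuts-section : ∀ T l₀ l₁ →
      (∀ P → ∃[ h ] ∃[ k ] (k ≢ 0# × (∀ x → curvePoint T P x ≡ k * sectionPoint l₀ l₁ h x))) →
      (∀ h → ∃[ P ] ∃[ k ] (k ≢ 0# × (∀ x → curvePoint T P x ≡ k * sectionPoint l₀ l₁ h x))) →
      CutsSection T l₀ l₁
    cuts-section T l₀ l₁ to-section from-section y = forward ∘ onCurve⇒curvePoint T , backward
      where
      forward : ∃[ P ] ∃[ k ] (k ≢ 0# × (∀ x → y x ≡ k * curvePoint T P x)) → OnSection l₀ l₁ y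
      forward (P , k , k≢0 , eq) =
        let h , m , m≢0 , eq′ = to-section P
        in h , k * m , *-nonzero k≢0 m≢0 , λ x → trans (eq x) (trans (cong (k *_) (eq′ x)) (sym (*-assoc k m _)))
      backward : OnSection l₀ l₁ y → points T y
      backward (h , k , k≢0 , eq) =
        let P , m , m≢0 , eq′ = from-section h
            r , r≢0 , solve-k = divide k≢0
        in curvePoint-onCurve T P {m * r} {y} (*-nonzero m≢0 r≢0) (λ x →
             trans (eq′ x) (trans (cong (m *_) (solve-k (sym (eq x)))) (sym (*-assoc m r (y x)))))

    -- The vectors are the coefficients of s³, s²t, st², t³ in (l₀s + l₁t)·conic + cubic. Their
    -- components in the cubic solid are the `c j`, which already gives independence.
    sectionCubic : Carrier → Carrier → TwistedCubic
    sectionCubic l₀ l₁ = record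
      { a₀ = l₀ · b 0F ⊕ c 0F
      ; a₁ = l₁ · b 0F ⊕ l₀ · b 1F ⊕ c 1F
      ; a₂ = l₁ · b 1F ⊕ l₀ · b 2F ⊕ c 2F
      ; a₃ = l₁ · b 2F ⊕ c 3F
      ; indep = independent
      }
      where
      module _ (k₀ k₁ k₂ k₃ : Carrier) where
        e : Fin 3 → Carrier
        e 0F = k₀ * l₀ + k₁ * l₁
        e 1F = k₁ * l₀ + k₂ * l₁
        e 2F = k₂ * l₀ + k₃ * l₁
        f : Fin 4 → Carrier
        f 0F = k₀
        f 1F = k₁
        f 2F = k₂
        f 3F = k₃
        independent : (k₀ · (l₀ · b 0F ⊕ c 0F) ⊕ k₁ · (l₁ · b 0F ⊕ l₀ · b 1F ⊕ c 1F) ⊕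
          k₂ · (l₁ · b 1F ⊕ l₀ · b 2F ⊕ c 2F) ⊕ k₃ · (l₁ · b 2F ⊕ c 3F)) ≐ zeroV →
          k₀ ≡ 0# × k₁ ≡ 0# × k₂ ≡ 0# × k₃ ≡ 0#
        independent eq = f≡0 0F , f≡0 1F , f≡0 2F , f≡0 3F
          where
          f≡0 : ∀ j → f j ≡ 0#
          f≡0 = proj₂ (bc-independent e f (λ x → trans (sym (expand x)) (eq x)))
            where
            expand : ∀ x → _ ≡ _
            expand x = solve 13 (λ k₀ k₁ k₂ k₃ l₀ l₁ b₀ b₁ b₂ c₀ c₁ c₂ c₃ →
              k₀ :* (l₀ :* b₀ :+ c₀) :+ k₁ :* (l₁ :* b₀ :+ l₀ :* b₁ :+ c₁) :+
              k₂ :* (l₁ :* b₁ :+ l₀ :* b₂ :+ c₂) :+ k₃ :* (l₁ :* b₂ :+ c₃) :=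
              ((k₀ :* l₀ :+ k₁ :* l₁) :* b₀ :+ ((k₁ :* l₀ :+ k₂ :* l₁) :* b₁ :+ ((k₂ :* l₀ :+ k₃ :* l₁) :* b₂ :+ con (+ 0)))) :+
              (k₀ :* c₀ :+ (k₁ :* c₁ :+ (k₂ :* c₂ :+ (k₃ :* c₃ :+ con (+ 0)))))) refl
              k₀ k₁ k₂ k₃ l₀ l₁ (b 0F x) (b 1F x) (b 2F x) (c 0F x) (c 1F x) (c 2F x) (c 3F x)

    sectionCubic-cuts : ∀ l₀ l₁ → CutsSection (sectionCubic l₀ l₁) l₀ l₁
    sectionCubic-cuts l₀ l₁ = cuts-section (sectionCubic l₀ l₁) l₀ l₁
      (λ P → P , 1# , 1≢0 , expand P) (λ P → P , 1# , 1≢0 , expand P)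
      where
      1≢0 : 1# ≢ 0#
      1≢0 = 0≢1 ∘ sym
      expand : ∀ P x → curvePoint (sectionCubic l₀ l₁) P x ≡ 1# * sectionPoint l₀ l₁ P x
      expand P x = solve 11 (λ s t l₀ l₁ b₀ b₁ b₂ c₀ c₁ c₂ c₃ →
        s :* s :* s :* (l₀ :* b₀ :+ c₀) :+ s :* s :* t :* (l₁ :* b₀ :+ l₀ :* b₁ :+ c₁) :+
        s :* t :* t :* (l₁ :* b₁ :+ l₀ :* b₂ :+ c₂) :+ t :* t :* t :* (l₁ :* b₂ :+ c₃) :=
        con (+ 1) :* ((l₀ :* s :+ l₁ :* t) :* (s :* s :* b₀ :+ (s :* t :* b₁ :+ (t :* t :* b₂ :+ con (+ 0)))) :+
        con (+ 1) :* (s :* s :* s :* c₀ :+ (s :* s :* t :* c₁ :+ (s :* t :* t :* c₂ :+ (t :* t :* t :* c₃ :+ con (+ 0))))))) refl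
        (X P) (Y P) l₀ l₁ (b 0F x) (b 1F x) (b 2F x) (c 0F x) (c 1F x) (c 2F x) (c 3F x)

    cubic-cuts-section : 6 ℕ.≤ q → ∀ T → (∀ P → OnScroll (curvePoint T P)) → ∃[ l₀ ] ∃[ l₁ ] CutsSection T l₀ l₁
    cubic-cuts-section 6≤q T on-scroll =
      let l₀ , l₁ , eq = section
      in l₀ , l₁ , cuts-section T l₀ l₁
        (λ P → base P , μ P , μ≢0 P , λ x → curve P (eq P x))
        (λ h → hit l₀ l₁ eq (base-surjective h))
      where
      ℓ μ : Point → Carrier
      ℓ P = proj₁ (proj₂ (on-scroll P))
      μ P = proj₁ (proj₂ (proj₂ (on-scroll P)))
      base : Point → Point
      base P = proj₁ (on-scroll P)
      curve : ∀ P {x z} → sum (λ j → cubic P j * coefficients T j x) ≡ z → curvePoint T P x ≡ z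
      curve P {x} = trans (sym (sum₄ (λ j → cubic P j * coefficients T j x)))
      open CubicOnScroll 6≤q (coefficients T) (coefficients-independent T) ℓ μ base
        (λ P → proj₁ (proj₂ (proj₂ (proj₂ (on-scroll P)))))
        (λ P x → trans (sum₄ (λ j → cubic P j * coefficients T j x)) (proj₂ (proj₂ (proj₂ (proj₂ (on-scroll P)))) x))
        using (section; μ≢0; base-surjective)
      hit : ∀ l₀ l₁ → (∀ P x → sum (λ j → cubic P j * coefficients T j x) ≡ μ P * sectionPoint l₀ l₁ (base P) x) →
        ∀ {h} → ∃[ P ] base P ≡ h → ∃[ P ] ∃[ k ] (k ≢ 0# × (∀ x → curvePoint T P x ≡ k * sectionPoint l₀ l₁ h x))
      hit l₀ l₁ eq (P , refl) = P , μ P , μ≢0 P , λ x → curve P (eq P x)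

    sameSection⇒samePoints : ∀ T T′ {l₀ l₁ m₀ m₁} → CutsSection T l₀ l₁ → CutsSection T′ m₀ m₁ →
      l₀ ≡ m₀ × l₁ ≡ m₁ → SamePoints (points T) (points T′)
    sameSection⇒samePoints T T′ cuts cuts′ (refl , refl) y =
      (λ (y≢0 , y∈T)  → y≢0 , proj₂ (cuts′ y) (proj₁ (cuts y) y∈T)) ,
      (λ (y≢0 , y∈T′) → y≢0 , proj₂ (cuts y) (proj₁ (cuts′ y) y∈T′))

    distinctSections-meet : ∀ T T′ {l₀ l₁ m₀ m₁} → CutsSection T l₀ l₁ → CutsSection T′ m₀ m₁ →
      ¬ (l₀ ≡ m₀ × l₁ ≡ m₁) → MeetInExactlyOnePoint (points T) (points T′)
    distinctSections-meet T T′ {l₀} {l₁} {m₀} {m₁} cuts cuts′ l≢m =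
      x₀ , (x₀≢0 , proj₂ (cuts x₀) (R , 1# , 1≢0 , λ x → sym (*-identityˡ (x₀ x)))) ,
      (x₀≢0 , proj₂ (cuts′ x₀) (R , 1# , 1≢0 , λ x → trans (cong (λ n → scrollPoint n 1# R x) root) (sym (*-identityˡ _)))) ,
      λ y (_ , y∈T) (_ , y∈T′) → unique y (proj₁ (cuts y) y∈T) (proj₁ (cuts′ y) y∈T′)
      where
      1≢0 : 1# ≢ 0#
      1≢0 = 0≢1 ∘ sym
      R : Point
      R = proj₁ (linear-root l₀ l₁ m₀ m₁ l≢m)
      root : linear l₀ l₁ R ≡ linear m₀ m₁ R
      root = proj₂ (linear-root l₀ l₁ m₀ m₁ l≢m)
      x₀ : Vec7
      x₀ = sectionPoint l₀ l₁ R
      x₀≢0 : NonZero x₀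
      x₀≢0 = scrollPoint-nonzero R 1≢0
      unique : ∀ y → OnSection l₀ l₁ y → OnSection m₀ m₁ y → y ∼ x₀
      unique y (P , k , k≢0 , eq) y∈m = proportional (decidable-stable (P Fin.≟ R)
        -- A common point off the generator of `R` would be a second agreement of the two linear
        -- forms, making them equal.
        (λ P≢R → l≢m (linear-unique P≢R agree root)))
        where
        agree : linear l₀ l₁ P ≡ linear m₀ m₁ P
        agree = *-cancelˡ k≢0 (onSection-coordinates P k≢0 (λ x → trans (eq x) (scale-section k _ P x)) y∈m)
        proportional : P ≡ R → y ∼ x₀
        proportional refl = let r , r≢0 , solve-k = divide k≢0 in r , r≢0 , λ x → solve-k (sym (eq x))

    sectionThrough : ∀ {l m l′ m′ P Q} → P ≢ Q → m ≢ 0# → m′ ≢ 0# →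
      ∃[ l₀ ] ∃[ l₁ ] (l ≡ m * linear l₀ l₁ P × l′ ≡ m′ * linear l₀ l₁ Q)
    sectionThrough {l} {m} {l′} {m′} {P} {Q} P≢Q m≢0 m′≢0 =
      let r , mr≡1 = inverse m m≢0
          s , ms≡1 = inverse m′ m′≢0
          l₀ , l₁ , eP , eQ = interpolate P≢Q (r * l) (s * l′)
      in l₀ , l₁ , value mr≡1 eP , value ms≡1 eQ
      where
      value : ∀ {m r l z} → m * r ≡ 1# → z ≡ r * l → l ≡ m * z
      value {m} {r} {l} mr≡1 refl = sym (begin
        m * (r * l) ≡⟨ *-assoc m r l ⟨
        m * r * l   ≡⟨ cong (_* l) mr≡1 ⟩
        1# * l      ≡⟨ *-identityˡ l ⟩
        l           ∎)

    scrollPoint-onSection : ∀ {l₀ l₁ l m y} P → m ≢ 0# → l ≡ m * linear l₀ l₁ P →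
      (∀ x → y x ≡ scrollPoint l m P x) → OnSection l₀ l₁ y
    scrollPoint-onSection {l₀} {l₁} {_} {m} P m≢0 refl eq =
      P , m , m≢0 , λ x → trans (eq x) (sym (scale-section m (linear l₀ l₁ P) P x))

    section-unique : ∀ {l₀ l₁ m₀ m₁ l m l′ m′ P Q y z} → P ≢ Q → m ≢ 0# → m′ ≢ 0# →
      l ≡ m * linear l₀ l₁ P → l′ ≡ m′ * linear l₀ l₁ Q →
      (∀ x → y x ≡ scrollPoint l m P x) → (∀ x → z x ≡ scrollPoint l′ m′ Q x) →
      OnSection m₀ m₁ y → OnSection m₀ m₁ z → m₀ ≡ l₀ × m₁ ≡ l₁
    section-unique {P = P} {Q} P≢Q m≢0 m′≢0 eP eQ ey ez y∈ z∈ = linear-unique P≢Q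
      (*-cancelˡ m≢0 (trans (sym (onSection-coordinates P m≢0 ey y∈)) eP))
      (*-cancelˡ m′≢0 (trans (sym (onSection-coordinates Q m′≢0 ez z∈)) eQ))

  -- Reduction of the given surface to the normal form.

  module RuledQuintic (D : QuinticData) where
    open QuinticData D

    Δ : Carrier
    Δ = φa * φd + - (φb * φc)

    -- Parametrising both curves by φ(s,t), which turns φ into the identity, replaces
    -- the spanning vectors of the conic plane by the coefficients of conicPt ∘ adj φ.
    b : Fin 3 → Vec7
    b 0F x = φd * φd * b₀ x + - (φd * φc) * b₁ x + φc * φc * b₂ x
    b 1F x = - (φb * φd + φb * φd) * b₀ x + (φa * φd + φb * φc) * b₁ x + - (φa * φc + φa * φc) * b₂ x
    b 2F x = φb * φb * b₀ x + - (φb * φa) * b₁ x + φa * φa * b₂ x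

    c : Fin 4 → Vec7
    c 0F = c₀
    c 1F = c₁
    c 2F = c₂
    c 3F = c₃

    bc-independent : ∀ (e : Fin 3 → Carrier) (f : Fin 4 → Carrier) →
      (∀ x → sum (λ j → e j * b j x) + sum (λ j → f j * c j x) ≡ 0#) → (∀ j → e j ≡ 0#) × (∀ j → f j ≡ 0#)
    bc-independent e f eq = e≡0 , f≡0
      where
      y₀ y₁ y₂ : Carrier
      y₀ = φd * φd * e 0F + - (φb * φd + φb * φd) * e 1F + φb * φb * e 2F
      y₁ = - (φd * φc) * e 0F + (φa * φd + φb * φc) * e 1F + - (φb * φa) * e 2F
      y₂ = φc * φc * e 0F + - (φa * φc + φa * φc) * e 1F + φa * φa * e 2F
      regroup : ∀ x → y₀ * b₀ x + y₁ * b₁ x + y₂ * b₂ x ≡ sum (λ j → e j * b j x)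
      regroup x = solve 10 (λ a b c d e₀ e₁ e₂ b₀ b₁ b₂ →
        (d :* d :* e₀ :+ :- (b :* d :+ b :* d) :* e₁ :+ b :* b :* e₂) :* b₀ :+
        (:- (d :* c) :* e₀ :+ (a :* d :+ b :* c) :* e₁ :+ :- (b :* a) :* e₂) :* b₁ :+
        (c :* c :* e₀ :+ :- (a :* c :+ a :* c) :* e₁ :+ a :* a :* e₂) :* b₂ :=
        e₀ :* (d :* d :* b₀ :+ :- (d :* c) :* b₁ :+ c :* c :* b₂) :+
        (e₁ :* (:- (b :* d :+ b :* d) :* b₀ :+ (a :* d :+ b :* c) :* b₁ :+ :- (a :* c :+ a :* c) :* b₂) :+
        (e₂ :* (b :* b :* b₀ :+ :- (b :* a) :* b₁ :+ a :* a :* b₂) :+ con (+ 0)))) refl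
        φa φb φc φd (e 0F) (e 1F) (e 2F) (b₀ x) (b₁ x) (b₂ x)
      negate : ∀ {u k₀ k₁ k₂ k₃ v₀ v₁ v₂ v₃} → u + (k₀ * v₀ + (k₁ * v₁ + (k₂ * v₂ + (k₃ * v₃ + 0#)))) ≡ 0# →
        u ≡ - k₀ * v₀ + - k₁ * v₁ + - k₂ * v₂ + - k₃ * v₃
      negate {u} {k₀} {k₁} {k₂} {k₃} {v₀} {v₁} {v₂} {v₃} u+v≡0 = x∙y⁻¹≈ε⇒x≈y _ _ (trans
        (solve 9 (λ u k₀ k₁ k₂ k₃ v₀ v₁ v₂ v₃ →
          u :+ :- ((:- k₀) :* v₀ :+ (:- k₁) :* v₁ :+ (:- k₂) :* v₂ :+ (:- k₃) :* v₃) :=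
          u :+ (k₀ :* v₀ :+ (k₁ :* v₁ :+ (k₂ :* v₂ :+ (k₃ :* v₃ :+ con (+ 0)))))) refl u k₀ k₁ k₂ k₃ v₀ v₁ v₂ v₃)
        u+v≡0)
      conic-part : (y₀ · b₀ ⊕ y₁ · b₁ ⊕ y₂ · b₂) ≐ zeroV
      conic-part = disjoint y₀ y₁ y₂ (- f 0F) (- f 1F) (- f 2F) (- f 3F)
        (λ x → trans (regroup x) (negate (eq x)))
      y≡0 : y₀ ≡ 0# × y₁ ≡ 0# × y₂ ≡ 0#
      y≡0 = α-plane y₀ y₁ y₂ conic-part
      cancel : ∀ {k₀ k₁ k₂ z} → k₀ * y₀ + k₁ * y₁ + k₂ * y₂ ≡ Δ * Δ * z → z ≡ 0#
      cancel {k₀} {k₁} {k₂} {z} k·y≡ = *-zero-cancelˡ (*-nonzero φ-invertible φ-invertible) (begin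
        Δ * Δ * z                          ≡⟨ k·y≡ ⟨
        k₀ * y₀ + k₁ * y₁ + k₂ * y₂        ≡⟨ cong₂ _+_ (cong₂ (λ u v → k₀ * u + k₁ * v) (proj₁ y≡0) (proj₁ (proj₂ y≡0)))
                                                        (cong (k₂ *_) (proj₂ (proj₂ y≡0))) ⟩
        k₀ * 0# + k₁ * 0# + k₂ * 0#        ≡⟨ solve 3 (λ a b c → a :* con (+ 0) :+ b :* con (+ 0) :+ c :* con (+ 0) := con (+ 0)) refl k₀ k₁ k₂ ⟩
        0#                                 ∎)
      -- The map from `e` to the `y` is the symmetric square of adj φ. The multipliers are the rows
      -- of the symmetric square of φ, and the two matrices compose to Δ² times the identity.
      e≡0 : ∀ j → e j ≡ 0#
      e≡0 0F = cancel {φa * φa} {φa * φb + φa * φb} {φb * φb} (solve 7 (λ a b c d e₀ e₁ e₂ →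
        a :* a :* (d :* d :* e₀ :+ :- (b :* d :+ b :* d) :* e₁ :+ b :* b :* e₂) :+
        (a :* b :+ a :* b) :* (:- (d :* c) :* e₀ :+ (a :* d :+ b :* c) :* e₁ :+ :- (b :* a) :* e₂) :+
        b :* b :* (c :* c :* e₀ :+ :- (a :* c :+ a :* c) :* e₁ :+ a :* a :* e₂) :=
        (a :* d :+ :- (b :* c)) :* (a :* d :+ :- (b :* c)) :* e₀) refl φa φb φc φd (e 0F) (e 1F) (e 2F))
      e≡0 1F = cancel {φa * φc} {φa * φd + φb * φc} {φb * φd} (solve 7 (λ a b c d e₀ e₁ e₂ →
        a :* c :* (d :* d :* e₀ :+ :- (b :* d :+ b :* d) :* e₁ :+ b :* b :* e₂) :+
        (a :* d :+ b :* c) :* (:- (d :* c) :* e₀ :+ (a :* d :+ b :* c) :* e₁ :+ :- (b :* a) :* e₂) :+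
        b :* d :* (c :* c :* e₀ :+ :- (a :* c :+ a :* c) :* e₁ :+ a :* a :* e₂) :=
        (a :* d :+ :- (b :* c)) :* (a :* d :+ :- (b :* c)) :* e₁) refl φa φb φc φd (e 0F) (e 1F) (e 2F))
      e≡0 2F = cancel {φc * φc} {φc * φd + φc * φd} {φd * φd} (solve 7 (λ a b c d e₀ e₁ e₂ →
        c :* c :* (d :* d :* e₀ :+ :- (b :* d :+ b :* d) :* e₁ :+ b :* b :* e₂) :+
        (c :* d :+ c :* d) :* (:- (d :* c) :* e₀ :+ (a :* d :+ b :* c) :* e₁ :+ :- (b :* a) :* e₂) :+
        d :* d :* (c :* c :* e₀ :+ :- (a :* c :+ a :* c) :* e₁ :+ a :* a :* e₂) :=
        (a :* d :+ :- (b :* c)) :* (a :* d :+ :- (b :* c)) :* e₂) refl φa φb φc φd (e 0F) (e 1F) (e 2F))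
      f≡0 : ∀ j → f j ≡ 0#
      f≡0 = each (Π-solid (f 0F) (f 1F) (f 2F) (f 3F) (λ x → trans (sym (sum₄ (λ j → f j * c j x))) (begin
        sum (λ j → f j * c j x)                                   ≡⟨ +-identityˡ _ ⟨
        0# + sum (λ j → f j * c j x)                              ≡⟨ cong (_+ sum (λ j → f j * c j x)) (trans (sym (regroup x)) (conic-part x)) ⟨
        sum (λ j → e j * b j x) + sum (λ j → f j * c j x)         ≡⟨ eq x ⟩
        0#                                                        ∎)))
        where
        each : f 0F ≡ 0# × f 1F ≡ 0# × f 2F ≡ 0# × f 3F ≡ 0# → ∀ j → f j ≡ 0#
        each (f₀ , _ , _ , _) 0F = f₀
        each (_ , f₁ , _ , _) 1F = f₁
        each (_ , _ , f₂ , _) 2F = f₂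
        each (_ , _ , _ , f₃) 3F = f₃

    open Independent b c bc-independent public

    module _ (P : Point) (k : Carrier) where
      -- This is k · adj φ applied to the representative of `P`; the factor `k` is kept because the
      -- homogeneous parameters of a generator come with an arbitrary scale.
      s t : Carrier
      s = k * (φd * X P + - (φb * Y P))
      t = k * (φa * Y P + - (φc * X P))

      conicPt-adj : ∀ x → conicPt s t x ≡ k * k * conicPoint P x
      conicPt-adj x = solve 10 (λ a b c d k u v b₀ b₁ b₂ →
        k :* (d :* u :+ :- (b :* v)) :* (k :* (d :* u :+ :- (b :* v))) :* b₀ :+
        k :* (d :* u :+ :- (b :* v)) :* (k :* (a :* v :+ :- (c :* u))) :* b₁ :+
        k :* (a :* v :+ :- (c :* u)) :* (k :* (a :* v :+ :- (c :* u))) :* b₂ :=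
        k :* k :* (u :* u :* (d :* d :* b₀ :+ :- (d :* c) :* b₁ :+ c :* c :* b₂) :+
        (u :* v :* (:- (b :* d :+ b :* d) :* b₀ :+ (a :* d :+ b :* c) :* b₁ :+ :- (a :* c :+ a :* c) :* b₂) :+
        (v :* v :* (b :* b :* b₀ :+ :- (b :* a) :* b₁ :+ a :* a :* b₂) :+ con (+ 0))))) refl
        φa φb φc φd k (X P) (Y P) (b₀ x) (b₁ x) (b₂ x)

      φ-adj : φa * s + φb * t ≡ k * Δ * X P × φc * s + φd * t ≡ k * Δ * Y P
      φ-adj =
        solve 7 (λ a b c d k u v → a :* (k :* (d :* u :+ :- (b :* v))) :+ b :* (k :* (a :* v :+ :- (c :* u))) :=
          k :* (a :* d :+ :- (b :* c)) :* u) refl φa φb φc φd k (X P) (Y P) ,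
        solve 7 (λ a b c d k u v → c :* (k :* (d :* u :+ :- (b :* v))) :+ d :* (k :* (a :* v :+ :- (c :* u))) :=
          k :* (a :* d :+ :- (b :* c)) :* v) refl φa φb φc φd k (X P) (Y P)

    cubicPt-scale : ∀ n P x → cubicPt (n * X P) (n * Y P) x ≡ n * n * n * cubicPoint P x
    cubicPt-scale n P x = solve 7 (λ k s t a b c d →
      k :* s :* (k :* s) :* (k :* s) :* a :+ k :* s :* (k :* s) :* (k :* t) :* b :+
      k :* s :* (k :* t) :* (k :* t) :* c :+ k :* t :* (k :* t) :* (k :* t) :* d :=
      k :* k :* k :* (s :* s :* s :* a :+ (s :* s :* t :* b :+ (s :* t :* t :* c :+ (t :* t :* t :* d :+ con (+ 0)))))) refl
      n (X P) (Y P) (c₀ x) (c₁ x) (c₂ x) (c₃ x)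

    imagePt-adj : ∀ P k x → imagePt (s P k) (t P k) x ≡ k * Δ * (k * Δ) * (k * Δ) * cubicPoint P x
    imagePt-adj P k x = trans
      (cong₂ (λ u v → cubicPt u v x) (proj₁ (φ-adj P k)) (proj₂ (φ-adj P k)))
      (cubicPt-scale (k * Δ) P x)

    adj-nonzero : ∀ P {k} → k ≢ 0# → NZPair (s P k) (t P k)
    adj-nonzero P {k} k≢0 (s≡0 , t≡0) = XY≢0 P
      ( cancel (trans (sym (proj₁ (φ-adj P k))) (null φa φb))
      , cancel (trans (sym (proj₂ (φ-adj P k))) (null φc φd)))
      where
      cancel : ∀ {z} → k * Δ * z ≡ 0# → z ≡ 0#
      cancel = *-zero-cancelˡ (*-nonzero k≢0 φ-invertible)
      null : ∀ m n → m * s P k + n * t P k ≡ 0#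
      null m n = trans (cong₂ (λ u v → m * u + n * v) s≡0 t≡0)
        (solve 2 (λ m n → m :* con (+ 0) :+ n :* con (+ 0) := con (+ 0)) refl m n)

    -- `P` is the normalised φ(u,v). Applying adj φ to φ(u,v) gives Δ·(u,v), and the division by Δ
    -- is absorbed into `k`.
    adj-surjective : ∀ {u v} → NZPair u v → ∃[ P ] ∃[ k ] (k ≢ 0# × u ≡ s P k × v ≡ t P k)
    adj-surjective {u} {v} uv≢0 = conclude (normalise (φa * u + φb * v) (φc * u + φd * v) uv′≢0) (divide φ-invertible)
      where
      invert : Δ * u ≡ φd * (φa * u + φb * v) + - (φb * (φc * u + φd * v)) ×
        Δ * v ≡ φa * (φc * u + φd * v) + - (φc * (φa * u + φb * v))
      invert =
        solve 6 (λ a b c d u v → (a :* d :+ :- (b :* c)) :* u := d :* (a :* u :+ b :* v) :+ :- (b :* (c :* u :+ d :* v)))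
          refl φa φb φc φd u v ,
        solve 6 (λ a b c d u v → (a :* d :+ :- (b :* c)) :* v := a :* (c :* u :+ d :* v) :+ :- (c :* (a :* u :+ b :* v)))
          refl φa φb φc φd u v
      uv′≢0 : NZPair (φa * u + φb * v) (φc * u + φd * v)
      uv′≢0 (eu , ev) = uv≢0
        ( *-zero-cancelˡ φ-invertible (trans (proj₁ invert) (null φd φb eu ev))
        , *-zero-cancelˡ φ-invertible (trans (proj₂ invert) (null φa φc ev eu)))
        where
        null : ∀ m n {y z} → y ≡ 0# → z ≡ 0# → m * y + - (n * z) ≡ 0#
        null m n refl refl = solve 2 (λ m n → m :* con (+ 0) :+ :- (n :* con (+ 0)) := con (+ 0)) refl m n
      conclude : ∃[ P ] ∃[ k ] (k ≢ 0# × φa * u + φb * v ≡ k * X P × φc * u + φd * v ≡ k * Y P) →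
        ∃[ r ] (r ≢ 0# × (∀ {y z} → Δ * y ≡ z → y ≡ r * z)) →
        ∃[ P ] ∃[ k ] (k ≢ 0# × u ≡ s P k × v ≡ t P k)
      conclude (P , k , k≢0 , eu , ev) (r , r≢0 , solve-Δ) = P , r * k , *-nonzero r≢0 k≢0 ,
        trans (solve-Δ (trans (proj₁ invert) (cong₂ (λ m n → φd * m + - (φb * n)) eu ev))) (pull φd φb (X P) (Y P)) ,
        trans (solve-Δ (trans (proj₂ invert) (cong₂ (λ m n → φa * m + - (φc * n)) ev eu))) (pull φa φc (Y P) (X P))
        where
        pull : ∀ m n y z → r * (m * (k * y) + - (n * (k * z))) ≡ r * k * (m * y + - (n * z))
        pull = solve 6 (λ r k m n y z → r :* (m :* (k :* y) :+ :- (n :* (k :* z))) := r :* k :* (m :* y :+ :- (n :* z))) refl r k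

    V⇒onScroll : ∀ {y} → V y → OnScroll y
    V⇒onScroll {y} (u , v , uv≢0 , l , m , lm≢0 , eq) = conclude (adj-surjective uv≢0)
      where
      conclude : ∃[ P ] ∃[ k ] (k ≢ 0# × u ≡ s P k × v ≡ t P k) → OnScroll y
      conclude (P , k , k≢0 , refl , refl) = P , l * (k * k) , m * (n * n * n) ,
        (λ (el , em) → lm≢0 (*-zero-cancelʳ (*-nonzero k≢0 k≢0) el , *-zero-cancelʳ (*-nonzero (*-nonzero n≢0 n≢0) n≢0) em)) ,
        λ x → trans (eq x) (cong₂ _+_
          (trans (cong (l *_) (conicPt-adj P k x)) (sym (*-assoc l (k * k) (conicPoint P x))))
          (trans (cong (m *_) (imagePt-adj P k x)) (sym (*-assoc m (n * n * n) (cubicPoint P x)))))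
        where
        n : Carrier
        n = k * Δ
        n≢0 : n ≢ 0#
        n≢0 = *-nonzero k≢0 φ-invertible

    1≢0 : 1# ≢ 0#
    1≢0 = 0≢1 ∘ sym

    conicPt-representative : ∀ P x → conicPt (s P 1#) (t P 1#) x ≡ conicPoint P x
    conicPt-representative P x = trans (conicPt-adj P 1# x)
      (solve 1 (λ z → con (+ 1) :* con (+ 1) :* z := z) refl (conicPoint P x))

    -- Fixing the scale at `1#` makes the generator depend on `P` alone, so two points with the same
    -- parameter exhibit a common generator.
    scrollPoint⇒generator : ∀ {y l m} P → ¬ (l ≡ 0# × m ≡ 0#) → (∀ x → y x ≡ scrollPoint l m P x) →
      generator (s P 1#) (t P 1#) y
    scrollPoint⇒generator {y} {l} {m} P lm≢0 eq = conclude (divide Δ³≢0)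
      where
      Δ³ : Carrier
      Δ³ = 1# * Δ * (1# * Δ) * (1# * Δ)
      Δ³≢0 : Δ³ ≢ 0#
      Δ³≢0 = *-nonzero (*-nonzero Δ′≢0 Δ′≢0) Δ′≢0
        where
        Δ′≢0 : 1# * Δ ≢ 0#
        Δ′≢0 = *-nonzero 1≢0 φ-invertible
      conclude : ∃[ r ] (r ≢ 0# × (∀ {y z} → Δ³ * y ≡ z → y ≡ r * z)) → generator (s P 1#) (t P 1#) y
      conclude (r , r≢0 , solve-Δ³) = l , m * r ,
        (λ (el , em) → lm≢0 (el , *-zero-cancelʳ r≢0 em)) ,
        λ x → trans (eq x) (cong₂ _+_
          (cong (l *_) (sym (conicPt-representative P x)))
          (trans (cong (m *_) (solve-Δ³ (sym (imagePt-adj P 1# x)))) (sym (*-assoc m r _))))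

    onScroll⇒V : ∀ {y} → OnScroll y → V y
    onScroll⇒V (P , l , m , lm≢0 , eq) =
      s P 1# , t P 1# , adj-nonzero P 1≢0 , scrollPoint⇒generator P lm≢0 eq

    offConic : ∀ {y l m} P → ¬ (l ≡ 0# × m ≡ 0#) → (∀ x → y x ≡ scrollPoint l m P x) → ¬ C y → m ≢ 0#
    offConic {y} {l} {m} P lm≢0 eq y∉C m≡0 = y∉C (conclude (divide l≢0))
      where
      l≢0 : l ≢ 0#
      l≢0 l≡0 = lm≢0 (l≡0 , m≡0)
      drop : ∀ {m} → m ≡ 0# → ∀ u v → l * u + m * v ≡ l * u
      drop refl = solve 3 (λ l u v → l :* u :+ con (+ 0) :* v := l :* u) refl l
      conclude : ∃[ r ] (r ≢ 0# × (∀ {y z} → l * y ≡ z → y ≡ r * z)) → C y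
      conclude (r , r≢0 , solve-l) = s P 1# , t P 1# , adj-nonzero P 1≢0 , r , r≢0 ,
        λ x → trans (conicPt-representative P x)
          (solve-l (sym (trans (eq x) (drop m≡0 (conicPoint P x) (cubicPoint P x)))))

    -- The two claims about twisted cubics on V.

    module _ (6≤q : 6 ℕ.≤ q) where

      cubic⊆V⇒section : ∀ T → points T ⊆ V → ∃[ l₀ ] ∃[ l₁ ] CutsSection T l₀ l₁
      cubic⊆V⇒section T T⊆V = cubic-cuts-section 6≤q T (λ P → V⇒onScroll (proj₂
        (T⊆V (curvePoint T P) (curvePoint-nonzero T P ,
          curvePoint-onCurve T P 1≢0 (λ x → sym (*-identityˡ (curvePoint T P x)))))))

      cubics-meet : (T₁ T₂ : TwistedCubic) → points T₁ ⊆ V → points T₂ ⊆ V →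
        ¬ SamePoints (points T₁) (points T₂) → MeetInExactlyOnePoint (points T₁) (points T₂)
      cubics-meet T₁ T₂ T₁⊆V T₂⊆V different =
        let _ , _ , cuts₁ = cubic⊆V⇒section T₁ T₁⊆V
            _ , _ , cuts₂ = cubic⊆V⇒section T₂ T₂⊆V
        in distinctSections-meet T₁ T₂ cuts₁ cuts₂ (different ∘ sameSection⇒samePoints T₁ T₂ cuts₁ cuts₂)

      unique-cubic-through : (P Q : Vec7) → P ∈ V → Q ∈ V → OnDifferentGenerators P Q →
        ¬ (P ∈ C) → ¬ (Q ∈ C) →
        ∃[ T ] (points T ⊆ V × P ∈ points T × Q ∈ points T ×
          ((T′ : TwistedCubic) → points T′ ⊆ V → P ∈ points T′ → Q ∈ points T′ →
             SamePoints (points T′) (points T)))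
      unique-cubic-through P Q (P≢0 , P∈V) (Q≢0 , Q∈V) different P∉C Q∉C =
        conclude (V⇒onScroll P∈V) (V⇒onScroll Q∈V)
        where
        Goal : Set
        Goal = ∃[ T ] (points T ⊆ V × P ∈ points T × Q ∈ points T ×
          ((T′ : TwistedCubic) → points T′ ⊆ V → P ∈ points T′ → Q ∈ points T′ →
             SamePoints (points T′) (points T)))
        module _ {h l m h′ l′ m′} (h≢h′ : h ≢ h′) (m≢0 : m ≢ 0#) (m′≢0 : m′ ≢ 0#)
          (eP : ∀ x → P x ≡ scrollPoint l m h x) (eQ : ∀ x → Q x ≡ scrollPoint l′ m′ h′ x) where
          from-section : ∃[ l₀ ] ∃[ l₁ ] (l ≡ m * linear l₀ l₁ h × l′ ≡ m′ * linear l₀ l₁ h′) → Goal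
          from-section (l₀ , l₁ , el , el′) =
            sectionCubic l₀ l₁ ,
            (λ y (y≢0 , y∈T) → y≢0 , onScroll⇒V (onSection⇒onScroll (proj₁ (cuts y) y∈T))) ,
            (P≢0 , proj₂ (cuts P) (scrollPoint-onSection h m≢0 el eP)) ,
            (Q≢0 , proj₂ (cuts Q) (scrollPoint-onSection h′ m′≢0 el′ eQ)) ,
            λ T′ T′⊆V (_ , P∈T′) (_ , Q∈T′) → same T′ (cubic⊆V⇒section T′ T′⊆V) P∈T′ Q∈T′
            where
            cuts : CutsSection (sectionCubic l₀ l₁) l₀ l₁
            cuts = sectionCubic-cuts l₀ l₁
            same : ∀ T′ → ∃[ m₀ ] ∃[ m₁ ] CutsSection T′ m₀ m₁ → points T′ P → points T′ Q →
              SamePoints (points T′) (points (sectionCubic l₀ l₁))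
            same T′ (_ , _ , cuts′) P∈T′ Q∈T′ = sameSection⇒samePoints T′ (sectionCubic l₀ l₁) cuts′ cuts
              (section-unique {P = h} {h′} h≢h′ m≢0 m′≢0 el el′ eP eQ (proj₁ (cuts′ P) P∈T′) (proj₁ (cuts′ Q) Q∈T′))
        conclude : OnScroll P → OnScroll Q → Goal
        conclude (h , l , m , lm≢0 , eP) (h′ , l′ , m′ , lm′≢0 , eQ) =
          from-section h≢h′ m≢0 m′≢0 eP eQ (sectionThrough h≢h′ m≢0 m′≢0)
          where
          h≢h′ : h ≢ h′
          h≢h′ refl = different (s h 1# , t h 1# , adj-nonzero h 1≢0 ,
            (P≢0 , scrollPoint⇒generator h lm≢0 eP) , (Q≢0 , scrollPoint⇒generator h lm′≢0 eQ))
          m≢0 : m ≢ 0#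
          m≢0 = offConic h lm≢0 eP (λ P∈C → P∉C (P≢0 , P∈C))
          m′≢0 : m′ ≢ 0#
          m′≢0 = offConic h′ lm′≢0 eQ (λ Q∈C → Q∉C (Q≢0 , Q∈C))

theorem3p5 : (q : ℕ) → IsPrimePower q → 6 ≤ q → (F : FiniteField q) →
    let open PG6 F in
    (D : QuinticData) →
    let open QuinticData D in
    ((T₁ T₂ : TwistedCubic) → points T₁ ⊆ V → points T₂ ⊆ V →
    ¬ SamePoints (points T₁) (points T₂) →
    MeetInExactlyOnePoint (points T₁) (points T₂))
    ×
    ((P Q : Vec7) → P ∈ V → Q ∈ V → OnDifferentGenerators P Q →
    ¬ (P ∈ C) → ¬ (Q ∈ C) →
    ∃[ T ] (points T ⊆ V × P ∈ points T × Q ∈ points T ×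
    ((T′ : TwistedCubic) → points T′ ⊆ V → P ∈ points T′ → Q ∈ points T′ →
    SamePoints (points T′) (points T))))
theorem3p5 q _ 6≤q F D = cubics-meet 6≤q , unique-cubic-through 6≤q
  where open Geometry F
        open RuledQuintic D
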